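{- Let $f:\{0,1\}^n\to\{0,1\}$ be symmetric, $c\in\mathbb{R}^n_{\ge0}$ any cost vector, $\varepsilon\in(0,0.5]$ and $\beta>0$. Then the online algorithm Warmup-IPRR$(f,\varepsilon)$ with unit investment $\beta$ is an $\varepsilon$-error algorithm with expected cost at most \[ \beta n+\mathrm{opt}^{\mathrm{avg}}_0(f,c)\cdot O\!\left(\log\frac1\varepsilon\right), \] where $O(\cdot)$ hides an absolute constant.
   Context: $f$ is symmetric if $f(x)=f(y)$ whenever $\sum_ix_i=\sum_iy_i$. Online priced query model: $f$ is given; input $x$ and costs $c$ unknown; investments $\theta$ start at $0$, each step one $\theta_i$ increases by $\beta$; $x_i$ is revealed once $\theta_i\ge c_i$; cost is $\|\theta\|_1$ at halting; expected cost is over uniform $x\in\{0,1\}^n$. An algorithm is $\varepsilon$-error if $\Pr_x[\text{output}\ne f(x)]\le\varepsilon$. $\mathrm{opt}^{\mathrm{avg}}_0(f,c)$ is the infimum of expected cost over all zero-error algorithms (offline ones know $c$ and pay $c_i$ per revealed $x_i$). $\mathrm{Inf}_i[g]=\Pr_x[g(x)\ne g(x^{\oplus i})]$; for a restriction $\pi$, $f_\pi$ is the restricted function; $\mathrm{bias}(g)=\min\{\Pr_x[g\ne0],\Pr_x[g\ne1]\}$. Warmup-IPRR$(f,\varepsilon)$: start with $\theta=0,\pi=\emptyset$; while $\mathrm{bias}(f_\pi)>\varepsilon$: pick $i^*\in\arg\max_i\mathrm{Inf}_i[f_\pi]/\theta_i$, increase $\theta_{i^*}$ by $\beta$, and if $x_{i^*}$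 is revealed as $b$ add $x_{i^*}\mapsto b$ to $\pi$; output $\mathbf{1}\{\mathbb{E}_x[f_\pi(x)]\ge1/2\}$. -}

module Defs where

open import Algebra.Bundles using (CommutativeRing; Semiring)
import Algebra.Construct.NaturalChoice.Min as Min
import Algebra.Definitions.RawSemiring as RawSemiringDefinitions
open import Data.Bool.Base using (Bool; true; false; not; if_then_else_; _xor_)
open import Data.Fin.Base using (Fin)
open import Data.Fin.Subset using (Subset; ⁅_⁆; _∪_) renaming (⊥ to ∅)
open import Data.List.Base using (List; []; _∷_)
open import Data.Maybe.Base using (Maybe; just; nothing; fromMaybe)
open import Data.Nat.Base using (ℕ; zero; suc)
open import Data.Product.Base using (Σ; ∃; _,_; proj₁; _×_)
open import Data.Vec.Base as Vec using (Vec; []; _∷_)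
open import Data.Vec.Functional as Functional using (Vector)
open import Function.Bundles using (_⇔_)
open import Level using (_⊔_) renaming (suc to ℓ-suc)
open import Relation.Binary.Bundles using (TotalOrder)
import Relation.Binary.Construct.Add.Supremum.NonStrict as AddSupremum
import Relation.Binary.Construct.NonStrictToStrict as Strict
open import Relation.Binary.Core using (Rel)
open import Relation.Binary.PropositionalEquality.Core using (_≡_)
open import Relation.Binary.Structures using (IsDecTotalOrder)
open import Relation.Nullary.Construct.Add.Supremum using (_⁺; [_]; ⊤⁺)
open import Relation.Nullary.Decidable.Core using (yes; no; does)
open import Relation.Nullary.Negation.Core using (¬_)

-- The standard library has no real numbers.  The reals are replaced by an
-- arbitrary Archimedean ordered field with decidable order; classically ℝ is
-- one.  Infima and logarithms are never assumed to exist, but enter through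
-- their defining properties (IsOpt₀ and IsLog₂ below).

record ArchimedeanOrderedField a ℓ₁ ℓ₂ : Set (ℓ-suc (a ⊔ ℓ₁ ⊔ ℓ₂)) where
  field
    commutativeRing : CommutativeRing a ℓ₁

  open CommutativeRing commutativeRing public hiding (zero)
  open RawSemiringDefinitions (Semiring.rawSemiring semiring) public
    using (sum; _^_) renaming (_×_ to _·_)

  infix  4 _≤_
  infix  8 _⁻¹

  field
    _≤_             : Rel Carrier ℓ₂
    isDecTotalOrder : IsDecTotalOrder _≈_ _≤_
    +-monoˡ-≤       : ∀ z {x y} → x ≤ y → x + z ≤ y + z
    *-nonNeg        : ∀ {x y} → 0# ≤ x → 0# ≤ y → 0# ≤ x * y
    0≉1             : ¬ (0# ≈ 1#)
    -- 0# ⁻¹ is unconstrained.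
    _⁻¹             : Carrier → Carrier
    *-inverseʳ      : ∀ {x} → ¬ (x ≈ 0#) → x * x ⁻¹ ≈ 1#
    archimedean     : ∀ x → ∃ λ m → x ≤ m · 1#

  open IsDecTotalOrder isDecTotalOrder public
    using (_≟_; _≤?_; isTotalOrder)

  totalOrder : TotalOrder a ℓ₁ ℓ₂
  totalOrder = record { isTotalOrder = isTotalOrder }

  open Min totalOrder public using (_⊓_)
  open Strict _≈_ _≤_ public using (_<_; <-decidable)
  open AddSupremum _≤_ public using (_≤⁺_)

  _<?_ = <-decidable _≟_ _≤?_

  fromℕ : ℕ → Carrier
  fromℕ m = m · 1#

  2# ½ : Carrier
  2# = fromℕ 2
  ½  = 2# ⁻¹

  -- For a > 0, L = log₂ a: L and log₂ a lie below the same rationals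
  -- (p - r) / q, all of them compared without division or subtraction.
  IsLog₂ : Carrier → Carrier → Set ℓ₂
  IsLog₂ a L = ∀ p q r →
    (fromℕ q * L + fromℕ r ≤ fromℕ p) ⇔ (a ^ q * 2# ^ r ≤ 2# ^ p)

Input : ℕ → Set
Input n = Vec Bool n

BooleanFunction : ℕ → Set
BooleanFunction n = Input n → Bool

weight : ∀ {n} → Input n → ℕ
weight x = Vec.sum (Vec.map (λ b → if b then 1 else 0) x)

Symmetric : ∀ {n} → BooleanFunction n → Set
Symmetric f = ∀ x y → weight x ≡ weight y → f x ≡ f y

flip : ∀ {n} → Fin n → Input n → Input n
flip i x = Vec.updateAt x i not

Restriction : ℕ → Set
Restriction n = Vec (Maybe Bool) n

-- f ↾ π is kept as a function of all n bits that ignores the bits fixed by π,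
-- which changes neither its bias, nor its mean, nor the influence of the free
-- bits; the fixed bits get influence 0.
_↾_ : ∀ {n} → BooleanFunction n → Restriction n → BooleanFunction n
(f ↾ π) x = f (Vec.zipWith fromMaybe x π)

data DecisionTree (n : ℕ) : Set where
  leaf  : Bool → DecisionTree n
  query : Fin n → (if0 if1 : DecisionTree n) → DecisionTree n

evaluate : ∀ {n} → DecisionTree n → BooleanFunction n
evaluate (leaf b)            x = b
evaluate (query i if0 if1) x =
  if Vec.lookup x i then evaluate if1 x else evaluate if0 x

-- A set, so that querying a bit twice is paid for only once.
queried : ∀ {n} → DecisionTree n → Input n → Subset n
queried (leaf b)            x = ∅
queried (query i if0 if1) x =
  ⁅ i ⁆ ∪ (if Vec.lookup x i then queried if1 x else queried if0 x)

-- The investments made so far, the most recent one first.  Each comes with the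
-- bit that was visible after it, or nothing if the cost was not yet reached.
Transcript : ℕ → Set
Transcript n = List (Fin n × Maybe Bool)

known : ∀ {n} → Transcript n → Restriction n
known []                 = Vec.replicate _ nothing
known ((i , just b) ∷ h) = known h Vec.[ i ]≔ just b
known ((i , nothing) ∷ h) = known h

data Action (n : ℕ) : Set where
  halt   : (output : Bool) → Action n
  invest : Fin n → Action n

-- An online algorithm sees the transcript only, neither the costs nor the input.
OnlineAlgorithm : ℕ → Set
OnlineAlgorithm n = Transcript n → Action n

module PricedQueries {a ℓ₁ ℓ₂} (K : ArchimedeanOrderedField a ℓ₁ ℓ₂) where

  open ArchimedeanOrderedField K public

  -- Expectation over uniform x, one fair bit at a time.
  𝔼 : ∀ {n} → (Input n → Carrier) → Carrier
  𝔼 {zero}  g = g []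
  𝔼 {suc n} g = ½ * (𝔼 (λ x → g (false ∷ x)) + 𝔼 (λ x → g (true ∷ x)))

  indicator : Bool → Carrier
  indicator b = if b then 1# else 0#

  mean : ∀ {n} → BooleanFunction n → Carrier
  mean g = 𝔼 (λ x → indicator (g x))

  -- Pr[ g ≠ h ].
  disagreement : ∀ {n} → BooleanFunction n → BooleanFunction n → Carrier
  disagreement g h = mean (λ x → g x xor h x)

  Inf : ∀ {n} → Fin n → BooleanFunction n → Carrier
  Inf i g = disagreement g (λ x → g (flip i x))

  bias : ∀ {n} → BooleanFunction n → Carrier
  bias g = disagreement g (λ _ → false) ⊓ disagreement g (λ _ → true)

  ErrorAtMost : ∀ {n} → Carrier → BooleanFunction n → BooleanFunction n → Set ℓ₂
  ErrorAtMost ε f output = disagreement output f ≤ ε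

  offlineCost : ∀ {n} → Vector Carrier n → DecisionTree n → Carrier
  offlineCost c T =
    𝔼 (λ x → sum (λ i → if Vec.lookup (queried T x) i then c i else 0#))

  -- opt = opt^avg_0(f, c), the greatest lower bound of the expected costs of
  -- the zero-error offline algorithms.
  IsOpt₀ : ∀ {n} → BooleanFunction n → Vector Carrier n → Carrier → Set (a ⊔ ℓ₂)
  IsOpt₀ f c opt = IsLowerBound opt × (∀ l → IsLowerBound l → l ≤ opt)
    where
    IsLowerBound : Carrier → Set ℓ₂
    IsLowerBound l = ∀ T → ErrorAtMost 0# f (evaluate T) → l ≤ offlineCost c T

  module Online {n : ℕ} (β : Carrier) where

    investments : Transcript n → Vector Carrier n
    investments []            = λ _ → 0#
    investments ((i , _) ∷ h) =
      Functional.updateAt (investments h) i (_+ β)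

    -- ‖θ‖₁; the investments are non-negative.
    totalInvestment : Transcript n → Carrier
    totalInvestment h = sum (investments h)

    -- Whether the bit is visible depends on the investment including the
    -- increment just made.
    extend : Vector Carrier n → Input n → Transcript n → Fin n → Transcript n
    extend c x h i = (i , visible) ∷ h
      where
      visible : Maybe Bool
      visible =
        if does (c i ≤? investments ((i , nothing) ∷ h) i)
        then just (Vec.lookup x i)
        else nothing

    data Run (A : OnlineAlgorithm n) (c : Vector Carrier n) (x : Input n)
           : (start end : Transcript n) → Bool → Set where
      halted   : ∀ {h b} → A h ≡ halt b → Run A c x h h b
      invested : ∀ {h h′ i b} → A h ≡ invest i →
                 Run A c x (extend c x h i) h′ b → Run A c x h h′ b

    record Execution (A : OnlineAlgorithm n) (c : Vector Carrier n)
                     (x : Input n) : Set where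
      field
        end    : Transcript n
        output : Bool
        run    : Run A c x [] end output

    Terminates : OnlineAlgorithm n → Vector Carrier n → Set
    Terminates A c = ∀ x → Execution A c x

    outputs : ∀ {A c} → Terminates A c → BooleanFunction n
    outputs t x = Execution.output (t x)

    expectedCost : ∀ {A c} → Terminates A c → Carrier
    expectedCost t = 𝔼 (λ x → totalInvestment (Execution.end (t x)))

    -- Inf_i[g] / θ_i, with value +∞ if only θ_i is zero, and 0 / 0 = 0.
    score : BooleanFunction n → Vector Carrier n → Fin n → Carrier ⁺
    score g θ i with θ i ≟ 0# | Inf i g ≟ 0#
    ... | no _  | _     = [ Inf i g * θ i ⁻¹ ]
    ... | yes _ | no _  = ⊤⁺
    ... | yes _ | yes _ = [ 0# ]

    IsArgMax : (Fin n → Carrier ⁺) → Fin n → Set (a ⊔ ℓ₂)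
    IsArgMax s i = ∀ j → s j ≤⁺ s i

    -- A rule choosing an element of the arg max; it may depend on everything
    -- the algorithm has seen.
    TieBreaking : BooleanFunction n → Carrier → Set (a ⊔ ℓ₁ ⊔ ℓ₂)
    TieBreaking f ε = ∀ h → ε < bias (f ↾ known h) →
      Σ (Fin n) (IsArgMax (score (f ↾ known h) (investments h)))

    warmupIPRR : (f : BooleanFunction n) (ε : Carrier) →
                 TieBreaking f ε → OnlineAlgorithm n
    warmupIPRR f ε pick h with ε <? bias (f ↾ known h)
    ... | yes ε<bias = invest (proj₁ (pick h ε<bias))
    ... | no  _      = halt (does (½ ≤? mean (f ↾ known h)))

{-# OPTIONS --safe #-}
module Submission where

-- The bound holds input by input.  By symmetry all free bits have the same
-- influence, so Warmup-IPRR always invests in a free bit with the smallest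
-- investment and raises the free bits level by level, in steps of β.  While
-- bias(f_π) > ε, every certificate of f consistent with π contains a
-- 1 / O(log(1/ε)) fraction of the m free bits: if it contains only q of them,
-- f_π is constant on the weights between q and m - q, and by Chernoff's bound
-- the binomial tails outside have probability at most ε unless
-- m = O(q log(1/ε)).  A bit that is still free after k levels costs at least
-- k β, so beyond the first level, which costs at most β n, the investments at
-- each level are charged to the bits queried by any zero-error tree.

open import Defs
import Algebra.Construct.NaturalChoice.Min
import Algebra.Construct.NaturalChoice.MinOp
import Algebra.Properties.Ring
import Algebra.Properties.Semiring.Mult
import Algebra.Properties.Semiring.Sum
import Algebra.Solver.Ring.NaturalCoefficients.Default
open import Data.Bool.Base using (Bool; true; false; if_then_else_; _xor_; _∨_)
import Data.Bool.Properties as Bool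
open import Data.Fin.Base using (Fin; zero; suc)
import Data.Fin.Properties as Fin
open import Data.Fin.Subset using (Subset; ⁅_⁆; _∪_)
open import Data.Fin.Subset.Properties using (x∈⁅x⁆)
open import Data.List.Base using ([]; _∷_)
open import Data.Maybe.Base using (Maybe; just; nothing; fromMaybe)
open import Data.Nat.Base as ℕ using (ℕ; zero; suc)
import Data.Nat.Properties as ℕ
open import Data.Product.Base using (Σ; ∃; _,_; proj₁; proj₂; _×_)
open import Data.Sum.Base using (_⊎_; inj₁; inj₂)
open import Data.Vec.Base as Vec using (Vec; []; _∷_)
import Data.Vec.Properties as Vec
open import Data.Vec.Functional as Functional using (Vector)
import Data.Vec.Functional.Properties as Functional
open import Function.Base using (_∘_)
open import Function.Bundles using (Equivalence)
open import Relation.Binary.Bundles using (TotalOrder)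
import Relation.Binary.Construct.Add.Supremum.NonStrict as AddSupremum
open import Relation.Binary.PropositionalEquality.Core as ≡ using (_≡_; _≢_)
import Relation.Binary.Reasoning.PartialOrder
open import Relation.Nullary.Decidable.Core using (yes; no; does)
open import Relation.Nullary.Negation.Core using (¬_; contradiction)

-- The bound on certificates concerns one restriction at a time, whereas the set of free bits
-- shrinks in the middle of a level. Each level is therefore charged once, to the bits that are free
-- when it is complete, and only when a further investment is due, so that the bias exceeds ε for
-- that very restriction. These inequalities add up over the levels, for every certificate at once.
-- A bit revealed inside a level is not charged for it, because the revealing increment may
-- overshoot its cost by up to β. Every bit is thus charged for all but at most one of its
-- increments, which gives the term β n. The tail bound is Markov's inequality in base 2: for w
-- binomial with m fair trials, 2 ^ (a - w) has mean 2 ^ a (3/4) ^ m, and the other end is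
-- symmetric. With q = a + b, both tails together have probability at most 2 ^ (q + 1) (3/4) ^ m. As
-- (3/4) ^ 3 < 1/2, this is at most 2 ^ (- l) once 3 (l + q + 1) ≤ m. Clearing denominators keeps
-- the whole computation in ℕ.

-- Binomial sums and their tails.

module BinomialSum where

  open import Data.Nat.Base
  open import Data.Nat.Properties
  open import Data.Nat.Tactic.RingSolver using (solve-∀)
  open import Relation.Binary.PropositionalEquality

  -- Σ_w C(m, w) ψ(w).
  binomialSum : ℕ → (ℕ → ℕ) → ℕ
  binomialSum zero    ψ = ψ 0
  binomialSum (suc m) ψ = binomialSum m ψ + binomialSum m (ψ ∘ suc)

  binomialSum-mono : ∀ m {ψ χ} → (∀ w → w ≤ m → ψ w ≤ χ w) →
                     binomialSum m ψ ≤ binomialSum m χ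
  binomialSum-mono zero    ψ≤χ = ψ≤χ 0 z≤n
  binomialSum-mono (suc m) ψ≤χ = +-mono-≤
    (binomialSum-mono m (λ w w≤m → ψ≤χ w (m≤n⇒m≤1+n w≤m)))
    (binomialSum-mono m (λ w w≤m → ψ≤χ (suc w) (s≤s w≤m)))

  binomialSum-cong : ∀ m {ψ χ} → (∀ w → w ≤ m → ψ w ≡ χ w) →
                     binomialSum m ψ ≡ binomialSum m χ
  binomialSum-cong m ψ≡χ = ≤-antisym
    (binomialSum-mono m (λ w w≤m → ≤-reflexive (ψ≡χ w w≤m)))
    (binomialSum-mono m (λ w w≤m → ≤-reflexive (sym (ψ≡χ w w≤m))))

  binomialSum-+ : ∀ m ψ χ → binomialSum m (λ w → ψ w + χ w) ≡
                  binomialSum m ψ + binomialSum m χ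
  binomialSum-+ zero    ψ χ = refl
  binomialSum-+ (suc m) ψ χ = trans
    (cong₂ _+_ (binomialSum-+ m ψ χ) (binomialSum-+ m (ψ ∘ suc) (χ ∘ suc)))
    (interchange (binomialSum m ψ) _ _ _)
    where
    interchange : ∀ a b c d → (a + b) + (c + d) ≡ (a + c) + (b + d)
    interchange = solve-∀

  binomialSum-* : ∀ m k ψ → binomialSum m (λ w → k * ψ w) ≡ k * binomialSum m ψ
  binomialSum-* zero    k ψ = refl
  binomialSum-* (suc m) k ψ = trans
    (cong₂ _+_ (binomialSum-* m k ψ) (binomialSum-* m k (ψ ∘ suc)))
    (sym (*-distribˡ-+ k _ _))

  binomialSum-zero : ∀ m {ψ} → (∀ w → w ≤ m → ψ w ≡ 0) → binomialSum m ψ ≡ 0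
  binomialSum-zero zero    ψ≡0 = ψ≡0 0 z≤n
  binomialSum-zero (suc m) ψ≡0 = cong₂ _+_
    (binomialSum-zero m (λ w w≤m → ψ≡0 w (m≤n⇒m≤1+n w≤m)))
    (binomialSum-zero m (λ w w≤m → ψ≡0 (suc w) (s≤s w≤m)))

  binomialSum≡0⇒ : ∀ m {ψ} → binomialSum m ψ ≡ 0 → ∀ w → w ≤ m → ψ w ≡ 0
  binomialSum≡0⇒ zero    eq zero    _         = eq
  binomialSum≡0⇒ (suc m) eq zero    _         =
    binomialSum≡0⇒ m (m+n≡0⇒m≡0 _ eq) 0 z≤n
  binomialSum≡0⇒ (suc m) {ψ} eq (suc w) (s≤s w≤m) =
    binomialSum≡0⇒ m (m+n≡0⇒n≡0 (binomialSum m ψ) eq) w w≤m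

  -- The binomial theorem for (1 + 2) ^ m; up to scaling, the exponential moment behind the tail
  -- bound.
  binomialSum-2^w : ∀ m → binomialSum m (2 ^_) ≡ 3 ^ m
  binomialSum-2^w zero    = refl
  binomialSum-2^w (suc m) = trans
    (cong (binomialSum m (2 ^_) +_) (binomialSum-* m 2 (2 ^_)))
    (cong (λ s → s + 2 * s) (binomialSum-2^w m))

  binomialSum-2^m∸w : ∀ m → binomialSum m (λ w → 2 ^ (m ∸ w)) ≡ 3 ^ m
  binomialSum-2^m∸w zero    = refl
  binomialSum-2^m∸w (suc m) = begin
    binomialSum m (λ w → 2 ^ (suc m ∸ w)) + s
      ≡⟨ cong (_+ s) (binomialSum-cong m (λ w w≤m →
           cong (2 ^_) (+-∸-assoc 1 w≤m))) ⟩
    binomialSum m (λ w → 2 * 2 ^ (m ∸ w)) + s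
      ≡⟨ cong (_+ s) (binomialSum-* m 2 _) ⟩
    2 * s + s
      ≡⟨ +-comm (2 * s) s ⟩
    3 * s
      ≡⟨ cong (3 *_) (binomialSum-2^m∸w m) ⟩
    3 ^ suc m ∎
    where
    open ≡-Reasoning
    s = binomialSum m (λ w → 2 ^ (m ∸ w))

  -- Chernoff's bound: where ψ does not vanish, one of the two exponentials
  -- 2 ^ (a - w) and 2 ^ (w + b - m) is at least 1.
  binomialSum-tails : ∀ m a b ψ → (∀ w → ψ w ≤ 1) →
                      (∀ w → a ≤ w → w + b ≤ m → ψ w ≡ 0) →
                      2 ^ m * binomialSum m ψ ≤ 2 ^ suc (a + b) * 3 ^ m
  binomialSum-tails m a b ψ ψ≤1 ψ≡0 = begin
    2 ^ m * binomialSum m ψ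
      ≡⟨ binomialSum-* m (2 ^ m) ψ ⟨
    binomialSum m (λ w → 2 ^ m * ψ w)
      ≤⟨ binomialSum-mono m pointwise ⟩
    binomialSum m (λ w → 2 ^ a * 2 ^ (m ∸ w) + 2 ^ b * 2 ^ w)
      ≡⟨ binomialSum-+ m _ _ ⟩
    binomialSum m (λ w → 2 ^ a * 2 ^ (m ∸ w)) + binomialSum m (λ w → 2 ^ b * 2 ^ w)
      ≡⟨ cong₂ _+_
           (trans (binomialSum-* m (2 ^ a) _) (cong (2 ^ a *_) (binomialSum-2^m∸w m)))
           (trans (binomialSum-* m (2 ^ b) _) (cong (2 ^ b *_) (binomialSum-2^w m))) ⟩
    2 ^ a * 3 ^ m + 2 ^ b * 3 ^ m
      ≡⟨ *-distribʳ-+ (3 ^ m) (2 ^ a) (2 ^ b) ⟨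
    (2 ^ a + 2 ^ b) * 3 ^ m
      ≤⟨ *-monoˡ-≤ (3 ^ m) (+-mono-≤ (^-monoʳ-≤ 2 (m≤m+n a b))
           (≤-trans (^-monoʳ-≤ 2 (m≤n+m b a)) (m≤m+n _ 0))) ⟩
    2 ^ suc (a + b) * 3 ^ m ∎
    where
    open ≤-Reasoning
    pointwise : ∀ w → w ≤ m → 2 ^ m * ψ w ≤ 2 ^ a * 2 ^ (m ∸ w) + 2 ^ b * 2 ^ w
    pointwise w w≤m with a ≤? w | w + b ≤? m
    ... | yes a≤w | yes w+b≤m =
      ≤-trans (≤-reflexive (trans (cong (2 ^ m *_) (ψ≡0 w a≤w w+b≤m)) (*-zeroʳ (2 ^ m)))) z≤n
    ... | no a≰w | _ = begin
      2 ^ m * ψ w                               ≤⟨ *-monoʳ-≤ (2 ^ m) (ψ≤1 w) ⟩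
      2 ^ m * 1                                 ≡⟨ *-identityʳ (2 ^ m) ⟩
      2 ^ m                                     ≡⟨ cong (2 ^_) (m+[n∸m]≡n w≤m) ⟨
      2 ^ (w + (m ∸ w))                         ≤⟨ ^-monoʳ-≤ 2 (+-monoˡ-≤ (m ∸ w) (<⇒≤ (≰⇒> a≰w))) ⟩
      2 ^ (a + (m ∸ w))                         ≡⟨ ^-distribˡ-+-* 2 a (m ∸ w) ⟩
      2 ^ a * 2 ^ (m ∸ w)                       ≤⟨ m≤m+n _ _ ⟩
      2 ^ a * 2 ^ (m ∸ w) + 2 ^ b * 2 ^ w       ∎
    ... | yes _ | no w+b≰m = begin
      2 ^ m * ψ w                               ≤⟨ *-monoʳ-≤ (2 ^ m) (ψ≤1 w) ⟩
      2 ^ m * 1                                 ≡⟨ *-identityʳ (2 ^ m) ⟩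
      2 ^ m                                     ≤⟨ ^-monoʳ-≤ 2 (<⇒≤ (≰⇒> w+b≰m)) ⟩
      2 ^ (w + b)                               ≡⟨ cong (2 ^_) (+-comm w b) ⟩
      2 ^ (b + w)                               ≡⟨ ^-distribˡ-+-* 2 b w ⟩
      2 ^ b * 2 ^ w                             ≤⟨ m≤n+m _ _ ⟩
      2 ^ a * 2 ^ (m ∸ w) + 2 ^ b * 2 ^ w       ∎

  ^-distribʳ-* : ∀ x y m → (x * y) ^ m ≡ x ^ m * y ^ m
  ^-distribʳ-* x y zero    = refl
  ^-distribʳ-* x y (suc m) = trans
    (cong (x * y *_) (^-distribʳ-* x y m)) (interchange x y _ _)
    where
    interchange : ∀ a b c d → (a * b) * (c * d) ≡ (a * c) * (b * d)
    interchange = solve-∀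

  -- Three factors 3/4 pay for one factor 2, because 2 · 27 = 54 ≤ 64.
  2^r*3^m≤4^m : ∀ r m → 3 * r ≤ m → 2 ^ r * 3 ^ m ≤ 4 ^ m
  2^r*3^m≤4^m r m 3r≤m = begin
    2 ^ r * 3 ^ m                         ≡⟨ cong (λ k → 2 ^ r * 3 ^ k) (m+[n∸m]≡n 3r≤m) ⟨
    2 ^ r * 3 ^ (3 * r + (m ∸ 3 * r))     ≡⟨ cong (2 ^ r *_) (^-distribˡ-+-* 3 (3 * r) _) ⟩
    2 ^ r * (3 ^ (3 * r) * 3 ^ (m ∸ 3 * r)) ≡⟨ *-assoc (2 ^ r) _ _ ⟨
    2 ^ r * 3 ^ (3 * r) * 3 ^ (m ∸ 3 * r) ≤⟨ *-mono-≤ 54≤64 (^-monoˡ-≤ (m ∸ 3 * r) (n≤1+n 3)) ⟩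
    4 ^ (3 * r) * 4 ^ (m ∸ 3 * r)         ≡⟨ ^-distribˡ-+-* 4 (3 * r) _ ⟨
    4 ^ (3 * r + (m ∸ 3 * r))             ≡⟨ cong (4 ^_) (m+[n∸m]≡n 3r≤m) ⟩
    4 ^ m                                 ∎
    where
    open ≤-Reasoning
    54≤64 : 2 ^ r * 3 ^ (3 * r) ≤ 4 ^ (3 * r)
    54≤64 = begin
      2 ^ r * 3 ^ (3 * r)  ≡⟨ cong (2 ^ r *_) (^-*-assoc 3 3 r) ⟨
      2 ^ r * 27 ^ r       ≡⟨ ^-distribʳ-* 2 27 r ⟨
      54 ^ r               ≤⟨ ^-monoˡ-≤ r (m≤m+n 54 10) ⟩
      64 ^ r               ≡⟨ ^-*-assoc 4 3 r ⟩
      4 ^ (3 * r)          ∎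

  -- The origin of the 9: with q = a + b and l, q ≥ 1, each of l, q and 1 is at most l q, so the
  -- required 3 (l + q + 1) is at most 9 l q.
  binomialSum-small : ∀ m a b ψ → (∀ w → ψ w ≤ 1) →
                      (∀ w → a ≤ w → w + b ≤ m → ψ w ≡ 0) →
                      ∀ l → 1 ≤ l → 9 * l * (a + b) ≤ m →
                      2 ^ l * binomialSum m ψ ≤ 2 ^ m
  binomialSum-small m a b ψ ψ≤1 ψ≡0 l 1≤l 9lq≤m with a + b in q≡
  -- For q = 0 the hypothesis on m is void, but there are no tails either: `ψ` vanishes on all
  -- weights.
  ... | zero = ≤-trans (≤-reflexive (trans (cong (2 ^ l *_) vanishes) (*-zeroʳ (2 ^ l)))) z≤n
    where
    vanishes : binomialSum m ψ ≡ 0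
    vanishes = binomialSum-zero m (λ w w≤m → ψ≡0 w
      (≤-trans (≤-reflexive (m+n≡0⇒m≡0 a q≡)) z≤n)
      (≤-trans (≤-reflexive (trans (cong (w +_) (m+n≡0⇒n≡0 a q≡)) (+-identityʳ w))) w≤m))
  ... | suc q = *-cancelˡ-≤ (2 ^ m) {{m^n≢0 2 m}} (begin
    2 ^ m * (2 ^ l * binomialSum m ψ)    ≡⟨ swap (2 ^ m) (2 ^ l) _ ⟩
    2 ^ l * (2 ^ m * binomialSum m ψ)    ≤⟨ *-monoʳ-≤ (2 ^ l) (binomialSum-tails m a b ψ ψ≤1 ψ≡0) ⟩
    2 ^ l * (2 ^ suc (a + b) * 3 ^ m)    ≡⟨ *-assoc (2 ^ l) _ _ ⟨
    2 ^ l * 2 ^ suc (a + b) * 3 ^ m      ≡⟨ cong (_* 3 ^ m) (^-distribˡ-+-* 2 l (suc (a + b))) ⟨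
    2 ^ (l + suc (a + b)) * 3 ^ m        ≤⟨ 2^r*3^m≤4^m (l + suc (a + b)) m (≤-trans exponent 9lq≤m) ⟩
    4 ^ m                                ≡⟨ ^-distribʳ-* 2 2 m ⟩
    2 ^ m * 2 ^ m                        ∎)
    where
    open ≤-Reasoning
    swap : ∀ x y z → x * (y * z) ≡ y * (x * z)
    swap = solve-∀
    exponent : 3 * (l + suc (a + b)) ≤ 9 * l * suc q
    exponent = begin
      3 * (l + suc (a + b))                ≡⟨ cong (λ k → 3 * (l + suc k)) q≡ ⟩
      3 * (l + suc (suc q))                ≡⟨ cong (λ k → 3 * (l + k)) (+-comm 1 (suc q)) ⟩
      3 * (l + (suc q + 1))                ≤⟨ *-monoʳ-≤ 3 (+-mono-≤ (m≤m*n l (suc q))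
                                               (+-mono-≤ (m≤n*m (suc q) l {{>-nonZero 1≤l}})
                                                 (*-mono-≤ 1≤l (s≤s (z≤n {q}))))) ⟩
      3 * (l * suc q + (l * suc q + l * suc q)) ≡⟨ collect l (suc q) ⟩
      9 * l * suc q                        ∎
      where
      collect : ∀ x y → 3 * (x * y + (x * y + x * y)) ≡ 9 * x * y
      collect = solve-∀

-- Arithmetic in an ordered field.

module OrderedField {a ℓ₁ ℓ₂} (K : ArchimedeanOrderedField a ℓ₁ ℓ₂) where

  open ArchimedeanOrderedField K
  open TotalOrder totalOrder public
    using (poset)
    renaming (refl to ≤-refl; reflexive to ≤-reflexive; trans to ≤-trans;
              antisym to ≤-antisym; total to ≤-total;
              ≤-respˡ-≈ to ≤-respˡ-≈; ≤-respʳ-≈ to ≤-respʳ-≈)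
  module ≤-Reasoning = Relation.Binary.Reasoning.PartialOrder poset
  open Algebra.Properties.Semiring.Mult semiring public
    using (×-homo-+; ×1-homo-*)
  open Algebra.Properties.Ring ring
    using (-‿distribˡ-*; -‿involutive)
  open Algebra.Solver.Ring.NaturalCoefficients.Default commutativeSemiring public
    using (solve; _:=_; _:+_; _:*_; con)
  open ≤-Reasoning

  +-monoʳ-≤ : ∀ z {x y} → x ≤ y → z + x ≤ z + y
  +-monoʳ-≤ z x≤y = ≤-respˡ-≈ (+-comm _ z) (≤-respʳ-≈ (+-comm _ z) (+-monoˡ-≤ z x≤y))

  +-mono-≤ : ∀ {x y u v} → x ≤ y → u ≤ v → x + u ≤ y + v
  +-mono-≤ x≤y u≤v = ≤-trans (+-monoˡ-≤ _ x≤y) (+-monoʳ-≤ _ u≤v)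

  +-nonNeg : ∀ {x y} → 0# ≤ x → 0# ≤ y → 0# ≤ x + y
  +-nonNeg 0≤x 0≤y = ≤-respˡ-≈ (+-identityˡ 0#) (+-mono-≤ 0≤x 0≤y)

  private
    x+z-z : ∀ x z → x + z + - z ≈ x
    x+z-z x z = trans (+-assoc x z (- z)) (trans (+-congˡ (-‿inverseʳ z)) (+-identityʳ x))

  +-cancelʳ-≤ : ∀ z {x y} → x + z ≤ y + z → x ≤ y
  +-cancelʳ-≤ z x+z≤y+z = ≤-respˡ-≈ (x+z-z _ z) (≤-respʳ-≈ (x+z-z _ z) (+-monoˡ-≤ (- z) x+z≤y+z))

  *-monoʳ-≤ : ∀ {z x y} → 0# ≤ z → x ≤ y → z * x ≤ z * y
  *-monoʳ-≤ {z} {x} {y} 0≤z x≤y = begin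
    z * x                       ≈⟨ +-identityˡ (z * x) ⟨
    0# + z * x                  ≤⟨ +-monoˡ-≤ (z * x) (*-nonNeg 0≤z 0≤y-x) ⟩
    z * (y + - x) + z * x       ≈⟨ distribˡ z _ x ⟨
    z * (y + - x + x)           ≈⟨ *-congˡ (trans (+-assoc y _ x)
                                     (trans (+-congˡ (-‿inverseˡ x)) (+-identityʳ y))) ⟩
    z * y                       ∎
    where
    0≤y-x : 0# ≤ y + - x
    0≤y-x = ≤-respˡ-≈ (-‿inverseʳ x) (+-monoˡ-≤ (- x) x≤y)

  *-monoˡ-≤ : ∀ {z x y} → 0# ≤ z → x ≤ y → x * z ≤ y * z
  *-monoˡ-≤ 0≤z x≤y = ≤-respˡ-≈ (*-comm _ _) (≤-respʳ-≈ (*-comm _ _) (*-monoʳ-≤ 0≤z x≤y))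

  0≤1 : 0# ≤ 1#
  0≤1 with ≤-total 0# 1#
  ... | inj₁ p = p
  ... | inj₂ 1≤0 = ≤-respʳ-≈ [-1]² (*-nonNeg 0≤-1 0≤-1)
    where
    0≤-1 : 0# ≤ - 1#
    0≤-1 = ≤-respˡ-≈ (-‿inverseʳ 1#) (≤-respʳ-≈ (+-identityˡ (- 1#)) (+-monoˡ-≤ (- 1#) 1≤0))
    [-1]² : - 1# * - 1# ≈ 1#
    [-1]² = trans (sym (-‿distribˡ-* 1# (- 1#))) (trans (-‿cong (*-identityˡ (- 1#))) (-‿involutive 1#))

  0<1 : 0# < 1#
  0<1 = 0≤1 , 0≉1

  <⇒≱ : ∀ {x y} → x < y → ¬ (y ≤ x)
  <⇒≱ (x≤y , x≉y) y≤x = x≉y (≤-antisym x≤y y≤x)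

  ≰⇒> : ∀ {x y} → ¬ (x ≤ y) → y < x
  ≰⇒> {x} {y} x≰y with ≤-total x y
  ... | inj₁ x≤y = contradiction x≤y x≰y
  ... | inj₂ y≤x = y≤x , λ y≈x → x≰y (≤-reflexive (sym y≈x))

  ≮⇒≥ : ∀ {x y} → ¬ (x < y) → y ≤ x
  ≮⇒≥ {x} {y} x≮y with ≤-total y x
  ... | inj₁ y≤x = y≤x
  ... | inj₂ x≤y with x ≟ y
  ...   | yes x≈y = ≤-reflexive (sym x≈y)
  ...   | no  x≉y = contradiction (x≤y , x≉y) x≮y

  <-≤-trans : ∀ {x y z} → x < y → y ≤ z → x < z
  <-≤-trans x<y y≤z = begin-strict _ <⟨ x<y ⟩ _ ≤⟨ y≤z ⟩ _ ∎

  ≤-<-trans : ∀ {x y z} → x ≤ y → y < z → x < z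
  ≤-<-trans x≤y y<z = begin-strict _ ≤⟨ x≤y ⟩ _ <⟨ y<z ⟩ _ ∎

  >⇒≉0 : ∀ {x} → 0# < x → ¬ (x ≈ 0#)
  >⇒≉0 (_ , 0≉x) x≈0 = 0≉x (sym x≈0)

  *-inverse-cancelʳ : ∀ {z} → 0# < z → ∀ x → x * z * z ⁻¹ ≈ x
  *-inverse-cancelʳ {z} 0<z x = trans (*-assoc x z _)
    (trans (*-congˡ (*-inverseʳ (>⇒≉0 0<z))) (*-identityʳ x))

  *-inverse-cancelʳ′ : ∀ {z} → 0# < z → ∀ x → x * z ⁻¹ * z ≈ x
  *-inverse-cancelʳ′ {z} 0<z x = trans (*-assoc x _ z)
    (trans (*-congˡ (trans (*-comm _ z) (*-inverseʳ (>⇒≉0 0<z)))) (*-identityʳ x))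

  *-cancelʳ-≈ : ∀ {z} → 0# < z → ∀ {x y} → x * z ≈ y * z → x ≈ y
  *-cancelʳ-≈ 0<z {x} {y} eq = trans (sym (*-inverse-cancelʳ 0<z x))
    (trans (*-congʳ eq) (*-inverse-cancelʳ 0<z y))

  *-cancelʳ-≤ : ∀ {z} → 0# < z → ∀ {x y} → x * z ≤ y * z → x ≤ y
  *-cancelʳ-≤ 0<z {x} {y} xz≤yz with ≤-total x y
  ... | inj₁ x≤y = x≤y
  ... | inj₂ y≤x = ≤-reflexive (*-cancelʳ-≈ 0<z (≤-antisym xz≤yz (*-monoˡ-≤ (proj₁ 0<z) y≤x)))

  *-monoˡ-< : ∀ {z} → 0# < z → ∀ {x y} → x < y → x * z < y * z
  *-monoˡ-< 0<z (x≤y , x≉y) = *-monoˡ-≤ (proj₁ 0<z) x≤y , λ eq → x≉y (*-cancelʳ-≈ 0<z eq)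

  *-pos : ∀ {x y} → 0# < x → 0# < y → 0# < x * y
  *-pos {x} {y} 0<x 0<y = ≤-<-trans (≤-reflexive (sym (zeroˡ y))) (*-monoˡ-< 0<y 0<x)

  ⁻¹-pos : ∀ {x} → 0# < x → 0# < x ⁻¹
  ⁻¹-pos {x} 0<x = ≰⇒> λ x⁻¹≤0 → <⇒≱ 0<1 (begin
    1#         ≈⟨ *-inverseʳ (>⇒≉0 0<x) ⟨
    x * x ⁻¹   ≤⟨ *-monoʳ-≤ (proj₁ 0<x) x⁻¹≤0 ⟩
    x * 0#     ≈⟨ zeroʳ x ⟩
    0#         ∎)

  fromℕ-+ : ∀ m n → fromℕ (m ℕ.+ n) ≈ fromℕ m + fromℕ n
  fromℕ-+ = ×-homo-+ 1#

  fromℕ-* : ∀ m n → fromℕ (m ℕ.* n) ≈ fromℕ m * fromℕ n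
  fromℕ-* = ×1-homo-*

  fromℕ-^ : ∀ k m → fromℕ (k ℕ.^ m) ≈ fromℕ k ^ m
  fromℕ-^ k zero    = +-identityʳ 1#
  fromℕ-^ k (suc m) = trans (fromℕ-* k (k ℕ.^ m)) (*-congˡ (fromℕ-^ k m))

  fromℕ-nonNeg : ∀ m → 0# ≤ fromℕ m
  fromℕ-nonNeg zero    = ≤-refl
  fromℕ-nonNeg (suc m) = +-nonNeg 0≤1 (fromℕ-nonNeg m)

  fromℕ-mono : ∀ {m n} → m ℕ.≤ n → fromℕ m ≤ fromℕ n
  fromℕ-mono {n = n} ℕ.z≤n       = fromℕ-nonNeg n
  fromℕ-mono         (ℕ.s≤s m≤n) = +-monoʳ-≤ 1# (fromℕ-mono m≤n)

  0<fromℕsuc : ∀ m → 0# < fromℕ (suc m)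
  0<fromℕsuc m = <-≤-trans 0<1 (≤-respˡ-≈ (+-identityʳ 1#) (+-monoʳ-≤ 1# (fromℕ-nonNeg m)))

  fromℕ-cancel-≤ : ∀ {m n} → fromℕ m ≤ fromℕ n → m ℕ.≤ n
  fromℕ-cancel-≤ {zero}          _   = ℕ.z≤n
  fromℕ-cancel-≤ {suc m} {zero}  m≤n = contradiction m≤n (<⇒≱ (0<fromℕsuc m))
  fromℕ-cancel-≤ {suc m} {suc n} m≤n = ℕ.s≤s (fromℕ-cancel-≤
    (+-cancelʳ-≤ 1# (≤-respˡ-≈ (+-comm 1# _) (≤-respʳ-≈ (+-comm 1# _) m≤n))))

  fromℕ-cancel-< : ∀ {m n} → fromℕ m < fromℕ n → m ℕ.< n
  fromℕ-cancel-< m<n = ℕ.≰⇒> (λ n≤m → <⇒≱ m<n (fromℕ-mono n≤m))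

  n<2^n : ∀ n → n ℕ.< 2 ℕ.^ n
  n<2^n zero    = ℕ.s≤s ℕ.z≤n
  n<2^n (suc n) = ℕ.+-mono-≤ (ℕ.m^n>0 2 n) (ℕ.≤-trans (n<2^n n) (ℕ.m≤m+n _ 0))

  0<2 : 0# < 2#
  0<2 = 0<fromℕsuc 1

  0<½ : 0# < ½
  0<½ = ⁻¹-pos 0<2

  ½*2x : ∀ x → ½ * (x + x) ≈ x
  ½*2x x = trans (*-congˡ (solve 1 (λ x → x :+ x := (con 1 :+ (con 1 :+ con 0)) :* x) refl x))
    (trans (sym (*-assoc ½ _ x)) (trans (*-congʳ ½*2≈1) (*-identityˡ x)))
    where
    ½*2≈1 : ½ * 2# ≈ 1#
    ½*2≈1 = trans (*-comm ½ 2#) (*-inverseʳ (>⇒≉0 0<2))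

  ^-pos : ∀ {x} → 0# < x → ∀ m → 0# < x ^ m
  ^-pos 0<x zero    = 0<1
  ^-pos 0<x (suc m) = *-pos 0<x (^-pos 0<x m)

  ½^m*2^m≈1 : ∀ m → ½ ^ m * fromℕ (2 ℕ.^ m) ≈ 1#
  ½^m*2^m≈1 m = trans (*-congˡ (fromℕ-^ 2 m)) (powers m)
    where
    powers : ∀ m → ½ ^ m * 2# ^ m ≈ 1#
    powers zero    = *-identityˡ 1#
    powers (suc m) = trans
      (solve 4 (λ h s t u → (h :* s) :* (t :* u) := (t :* h) :* (s :* u)) refl ½ _ 2# _)
      (trans (*-cong (*-inverseʳ (>⇒≉0 0<2)) (powers m)) (*-identityˡ 1#))

  sum-mono : ∀ {n} {u v : Vector Carrier n} → (∀ i → u i ≤ v i) → sum u ≤ sum v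
  sum-mono {zero}  u≤v = ≤-refl
  sum-mono {suc n} u≤v = +-mono-≤ (u≤v zero) (sum-mono (u≤v ∘ suc))

  sum-nonNeg : ∀ {n} {u : Vector Carrier n} → (∀ i → 0# ≤ u i) → 0# ≤ sum u
  sum-nonNeg {zero}  0≤u = ≤-refl
  sum-nonNeg {suc n} 0≤u = +-nonNeg (0≤u zero) (sum-nonNeg (0≤u ∘ suc))

-- Expectations over uniform inputs.

module Expectation {a ℓ₁ ℓ₂} (K : ArchimedeanOrderedField a ℓ₁ ℓ₂) where

  open PricedQueries K
  open OrderedField K
  open ≤-Reasoning

  private
    0≤½ : 0# ≤ ½
    0≤½ = proj₁ 0<½

  𝔼-mono : ∀ {n} {g h : Input n → Carrier} → (∀ x → g x ≤ h x) → 𝔼 g ≤ 𝔼 h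
  𝔼-mono {zero}  g≤h = g≤h []
  𝔼-mono {suc n} g≤h = *-monoʳ-≤ 0≤½
    (+-mono-≤ (𝔼-mono (g≤h ∘ (false ∷_))) (𝔼-mono (g≤h ∘ (true ∷_))))

  𝔼-cong : ∀ {n} {g h : Input n → Carrier} → (∀ x → g x ≈ h x) → 𝔼 g ≈ 𝔼 h
  𝔼-cong g≈h = ≤-antisym (𝔼-mono (≤-reflexive ∘ g≈h)) (𝔼-mono (≤-reflexive ∘ sym ∘ g≈h))

  𝔼-const : ∀ {n} c → 𝔼 {n} (λ _ → c) ≈ c
  𝔼-const {zero}  c = refl
  𝔼-const {suc n} c = trans (*-congˡ (+-cong (𝔼-const {n} c) (𝔼-const {n} c))) (½*2x c)

  𝔼-+ : ∀ {n} (g h : Input n → Carrier) → 𝔼 (λ x → g x + h x) ≈ 𝔼 g + 𝔼 h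
  𝔼-+ {zero}  g h = refl
  𝔼-+ {suc n} g h = trans (*-congˡ (+-cong (𝔼-+ (g ∘ (false ∷_)) (h ∘ (false ∷_))) (𝔼-+ (g ∘ (true ∷_)) (h ∘ (true ∷_)))))
    (solve 5 (λ k p q r s → k :* ((p :+ q) :+ (r :+ s)) := k :* (p :+ r) :+ k :* (q :+ s))
      refl ½ _ _ _ _)

  𝔼-*ˡ : ∀ {n} c (g : Input n → Carrier) → 𝔼 (λ x → c * g x) ≈ c * 𝔼 g
  𝔼-*ˡ {zero}  c g = refl
  𝔼-*ˡ {suc n} c g = trans (*-congˡ (+-cong (𝔼-*ˡ c (g ∘ (false ∷_))) (𝔼-*ˡ c (g ∘ (true ∷_)))))
    (solve 4 (λ k c p q → k :* (c :* p :+ c :* q) := c :* (k :* (p :+ q))) refl ½ c _ _)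

  𝔼-nonNeg : ∀ {n} {g : Input n → Carrier} → (∀ x → 0# ≤ g x) → 0# ≤ 𝔼 g
  𝔼-nonNeg {n} 0≤g = ≤-respˡ-≈ (𝔼-const {n} 0#) (𝔼-mono 0≤g)

  indicator-nonNeg : ∀ b → 0# ≤ indicator b
  indicator-nonNeg true  = 0≤1
  indicator-nonNeg false = ≤-refl

  mean-nonNeg : ∀ {n} (g : BooleanFunction n) → 0# ≤ mean g
  mean-nonNeg g = 𝔼-nonNeg (indicator-nonNeg ∘ g)

  mean-cong : ∀ {n} {g h : BooleanFunction n} → (∀ x → g x ≡ h x) → mean g ≈ mean h
  mean-cong g≡h = 𝔼-cong (λ x → reflexive (≡.cong indicator (g≡h x)))

  -- Both halves of the average are non-negative, so both vanish. This turns a zero-error tree into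
  -- one that agrees with f on every input.
  mean≤0⇒false : ∀ {n} (g : BooleanFunction n) → mean g ≤ 0# → ∀ x → g x ≡ false
  mean≤0⇒false {zero}  g p [] with g []
  ... | true  = contradiction p (<⇒≱ 0<1)
  ... | false = ≡.refl
  mean≤0⇒false {suc n} g p (b ∷ x) = mean≤0⇒false (g ∘ (b ∷_)) (half b) x
    where
    E : Bool → Carrier
    E b = mean (g ∘ (b ∷_))
    E₀+E₁≤0 : E false + E true ≤ 0#
    E₀+E₁≤0 = *-cancelʳ-≤ 0<½ (≤-respˡ-≈ (*-comm ½ _) (≤-respʳ-≈ (sym (zeroˡ ½)) p))
    half : ∀ b → E b ≤ 0#
    half false = begin
      E false            ≈⟨ +-identityʳ _ ⟨
      E false + 0#       ≤⟨ +-monoʳ-≤ _ (mean-nonNeg (g ∘ (true ∷_))) ⟩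
      E false + E true   ≤⟨ E₀+E₁≤0 ⟩
      0#                 ∎
    half true = begin
      E true             ≈⟨ +-identityˡ _ ⟨
      0# + E true        ≤⟨ +-monoˡ-≤ _ (mean-nonNeg (g ∘ (false ∷_))) ⟩
      E false + E true   ≤⟨ E₀+E₁≤0 ⟩
      0#                 ∎

module ℕ-Sum = Algebra.Properties.Semiring.Sum ℕ.+-*-semiring

-- Restrictions, weights and certificates.

module Restrictions where

  open import Data.Nat.Base using (_+_; _*_; _≤_; _<_; z≤n; s≤s; _^_)
  open import Relation.Binary.PropositionalEquality
  open BinomialSum
  open ℕ-Sum using (sum)

  private
    variable
      n : ℕ

  override : Input n → Restriction n → Input n
  override x π = Vec.zipWith fromMaybe x π

  free : Maybe Bool → ℕ
  free nothing  = 1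
  free (just _) = 0

  freeCount : Restriction n → ℕ
  freeCount π = sum (λ i → free (Vec.lookup π i))

  freeCountIn : Subset n → Restriction n → ℕ
  freeCountIn Q π = sum (λ i → if Vec.lookup Q i then free (Vec.lookup π i) else 0)

  freeCountIn≤freeCount : (Q : Subset n) (π : Restriction n) → freeCountIn Q π ≤ freeCount π
  freeCountIn≤freeCount []          []      = z≤n
  freeCountIn≤freeCount (true ∷ Q)  (p ∷ π) = ℕ.+-monoʳ-≤ (free p) (freeCountIn≤freeCount Q π)
  freeCountIn≤freeCount (false ∷ Q) (p ∷ π) = ℕ.+-mono-≤ (z≤n {free p}) (freeCountIn≤freeCount Q π)

  free-bit⇒freeCount : (π : Restriction n) (i : Fin n) → Vec.lookup π i ≡ nothing →
                       ∃ λ m → freeCount π ≡ suc m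
  free-bit⇒freeCount (nothing ∷ π) zero    _  = _ , refl
  free-bit⇒freeCount (nothing ∷ π) (suc i) _  = _ , refl
  free-bit⇒freeCount (just b ∷ π)  (suc i) eq = free-bit⇒freeCount π i eq

  freeCount⇒free-bit : (π : Restriction n) → ∀ {m} → freeCount π ≡ suc m →
                       ∃ λ i → Vec.lookup π i ≡ nothing
  freeCount⇒free-bit (nothing ∷ π) _  = zero , refl
  freeCount⇒free-bit (just b ∷ π)  eq with freeCount⇒free-bit π eq
  ... | i , πᵢ = suc i , πᵢ

  fixedWeight : Restriction n → ℕ
  fixedWeight []               = 0
  fixedWeight (nothing ∷ π)    = fixedWeight π
  fixedWeight (just false ∷ π) = fixedWeight π
  fixedWeight (just true ∷ π)  = suc (fixedWeight π)

  Consistent : Restriction n → Input n → Set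
  Consistent π x = ∀ i {b} → Vec.lookup π i ≡ just b → Vec.lookup x i ≡ b

  override-consistent : (π : Restriction n) (x : Input n) → Consistent π (override x π)
  override-consistent (just b ∷ π)  (_ ∷ x) zero    refl = refl
  override-consistent (just b ∷ π)  (_ ∷ x) (suc i) eq   = override-consistent π x i eq
  override-consistent (nothing ∷ π) (_ ∷ x) (suc i) eq   = override-consistent π x i eq

  consistent⇒override : (π : Restriction n) (x : Input n) → Consistent π x → override x π ≡ x
  consistent⇒override []            []      _ = refl
  consistent⇒override (nothing ∷ π) (b ∷ x) c = cong (b ∷_) (consistent⇒override π x (c ∘ suc))
  consistent⇒override (just _ ∷ π)  (b ∷ x) c =
    cong₂ _∷_ (sym (c zero refl)) (consistent⇒override π x (c ∘ suc))

  flip-fixed : (π : Restriction n) (i : Fin n) {b : Bool} → Vec.lookup π i ≡ just b →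
               ∀ x → override (flip i x) π ≡ override x π
  flip-fixed (just b ∷ π)  zero    _  (_ ∷ x) = refl
  flip-fixed (just b ∷ π)  (suc i) eq (_ ∷ x) = cong (b ∷_) (flip-fixed π i eq x)
  flip-fixed (nothing ∷ π) (suc i) eq (b ∷ x) = cong (b ∷_) (flip-fixed π i eq x)

  -- One representative per weight, through which a symmetric function becomes a function on ℕ. For
  -- `w > n` the value is the all-ones input.
  ones-first : ∀ n → ℕ → Input n
  ones-first zero    _       = []
  ones-first (suc n) zero    = false ∷ ones-first n zero
  ones-first (suc n) (suc w) = true ∷ ones-first n w

  weight-ones-first : ∀ (x : Input n) → weight (ones-first n (weight x)) ≡ weight x
  weight-ones-first {n} x = go n (weight≤n x)
    where
    go : ∀ n {w} → w ≤ n → weight (ones-first n w) ≡ w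
    go zero    z≤n       = refl
    go (suc n) z≤n       = go n z≤n
    go (suc n) (s≤s w≤n) = cong suc (go n w≤n)
    weight≤n : ∀ {n} (x : Input n) → weight x ≤ n
    weight≤n []          = z≤n
    weight≤n (true ∷ x)  = s≤s (weight≤n x)
    weight≤n (false ∷ x) = ℕ.m≤n⇒m≤1+n (weight≤n x)

  profile : BooleanFunction n → ℕ → Bool
  profile f w = f (ones-first _ w)

  symmetric⇒profile : {f : BooleanFunction n} → Symmetric f → ∀ x → f x ≡ profile f (weight x)
  symmetric⇒profile f-sym x = f-sym x _ (sym (weight-ones-first x))

  AgreeOn : Subset n → Input n → Input n → Set
  AgreeOn Q x y = ∀ i → Vec.lookup Q i ≡ true → Vec.lookup y i ≡ Vec.lookup x i

  Certificate : BooleanFunction n → Input n → Subset n → Set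
  Certificate f x Q = ∀ y → AgreeOn Q x y → f y ≡ f x

  Reaches : Restriction n → Subset n → Input n → ℕ → Set
  Reaches π Q x w = ∃ λ y → AgreeOn Q x y × weight y ≡ fixedWeight π + w

  -- a and b count the free ones and the free zeros of x in Q.
  weights-agreeing-on : (π : Restriction n) (Q : Subset n) (x : Input n) → Consistent π x →
    ∃ λ a → ∃ λ b → a + b ≡ freeCountIn Q π ×
      (∀ w → a ≤ w → w + b ≤ freeCount π → Reaches π Q x w)
  weights-agreeing-on [] [] [] _ = 0 , 0 , refl , λ { zero _ _ → [] , (λ ()) , refl }
  weights-agreeing-on (just β ∷ π) (q ∷ Q) (b₀ ∷ x) c
    with weights-agreeing-on π Q x (c ∘ suc)
  ... | a , b , a+b , reach = a , b , trans a+b (sym (drop q)) ,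
    λ w a≤w w+b≤m → prepend β (c zero refl) (reach w a≤w w+b≤m)
    where
    drop : ∀ q → (if q then 0 else 0) + freeCountIn Q π ≡ freeCountIn Q π
    drop true  = refl
    drop false = refl
    prepend : ∀ β {w} → b₀ ≡ β → Reaches π Q x w → Reaches (just β ∷ π) (q ∷ Q) (b₀ ∷ x) w
    prepend true  refl (y , agree , weight-y) =
      true ∷ y , (λ { zero _ → refl ; (suc i) → agree i }) , cong suc weight-y
    prepend false refl (y , agree , weight-y) =
      false ∷ y , (λ { zero _ → refl ; (suc i) → agree i }) , weight-y
  weights-agreeing-on (nothing ∷ π) (true ∷ Q) (true ∷ x) c
    with weights-agreeing-on π Q x (c ∘ suc)
  ... | a , b , a+b , reach = suc a , b , cong suc a+b , λ
    { (suc w) (s≤s a≤w) (s≤s w+b≤m) → prepend (reach w a≤w w+b≤m) }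
    where
    prepend : ∀ {w} → Reaches π Q x w → Reaches (nothing ∷ π) (true ∷ Q) (true ∷ x) (suc w)
    prepend {w} (y , agree , weight-y) = true ∷ y ,
      (λ { zero _ → refl ; (suc i) → agree i }) ,
      trans (cong suc weight-y) (sym (ℕ.+-suc (fixedWeight π) w))
  weights-agreeing-on (nothing ∷ π) (true ∷ Q) (false ∷ x) c
    with weights-agreeing-on π Q x (c ∘ suc)
  ... | a , b , a+b , reach = a , suc b , trans (ℕ.+-suc a b) (cong suc a+b) , λ
    w a≤w w+b≤m → prepend (reach w a≤w (ℕ.s≤s⁻¹ (subst (_≤ suc (freeCount π)) (ℕ.+-suc w b) w+b≤m)))
    where
    prepend : ∀ {w} → Reaches π Q x w → Reaches (nothing ∷ π) (true ∷ Q) (false ∷ x) w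
    prepend (y , agree , weight-y) =
      false ∷ y , (λ { zero _ → refl ; (suc i) → agree i }) , weight-y
  weights-agreeing-on (nothing ∷ π) (false ∷ Q) (b₀ ∷ x) c
    with weights-agreeing-on π Q x (c ∘ suc)
  ... | a , b , a+b , reach = a , b , a+b , extended
    where
    prepend-one : ∀ {w} → Reaches π Q x w → Reaches (nothing ∷ π) (false ∷ Q) (b₀ ∷ x) (suc w)
    prepend-one {w} (y , agree , weight-y) = true ∷ y , (λ { zero () ; (suc i) → agree i }) ,
      trans (cong suc weight-y) (sym (ℕ.+-suc (fixedWeight π) w))
    prepend-zero : ∀ {w} → Reaches π Q x w → Reaches (nothing ∷ π) (false ∷ Q) (b₀ ∷ x) w
    prepend-zero (y , agree , weight-y) = false ∷ y , (λ { zero () ; (suc i) → agree i }) , weight-y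
    a+b≤m : a + b ≤ freeCount π
    a+b≤m = ℕ.≤-trans (ℕ.≤-reflexive a+b) (freeCountIn≤freeCount Q π)
    extended : ∀ w → a ≤ w → w + b ≤ suc (freeCount π) →
               Reaches (nothing ∷ π) (false ∷ Q) (b₀ ∷ x) w
    -- A free bit outside `Q` may take either value. At the lower end w = a it has to be 0; for
    -- larger w it is set to 1, which leaves w - 1 ≥ a to the other bits and keeps the upper bound.
    extended w a≤w w+b≤1+m with ℕ.m≤n⇒m<n∨m≡n a≤w
    ... | inj₂ refl = prepend-zero (reach a a≤w a+b≤m)
    extended (suc w) _ (s≤s w+b≤m) | inj₁ (s≤s a≤w) = prepend-one (reach w a≤w w+b≤m)

  toℕ : Bool → ℕ
  toℕ b = if b then 1 else 0

  toℕ≤1 : ∀ b → toℕ b ≤ 1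
  toℕ≤1 true  = s≤s z≤n
  toℕ≤1 false = z≤n

  -- A certificate with few free bits determines f on all middle weights,
  -- which leaves only the tails of the binomial distribution to the bias.
  certificate-large : {f : BooleanFunction n} → Symmetric f →
    (π : Restriction n) (x : Input n) → Consistent π x →
    (Q : Subset n) → Certificate f x Q → ∀ l → 1 ≤ l →
    2 ^ freeCount π < 2 ^ l * binomialSum (freeCount π)
      (λ w → toℕ (profile f (fixedWeight π + w) xor f x)) →
    freeCount π ≤ 9 * l * freeCountIn Q π
  certificate-large {f = f} f-sym π x cons Q cert l 1≤l unsettled
    with freeCount π ℕ.≤? 9 * l * freeCountIn Q π | weights-agreeing-on π Q x cons
  ... | yes p | _ = p
  ... | no ¬p | a , b , a+b , inputs = contradiction
    (binomialSum-small (freeCount π) a b _ (λ _ → toℕ≤1 _) constant l 1≤l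
      (subst (λ q → 9 * l * q ≤ freeCount π) (sym a+b) (ℕ.<⇒≤ (ℕ.≰⇒> ¬p))))
    (ℕ.<⇒≱ unsettled)
    where
    constant : ∀ w → a ≤ w → w + b ≤ freeCount π →
               toℕ (profile f (fixedWeight π + w) xor f x) ≡ 0
    constant w a≤w w+b≤m with inputs w a≤w w+b≤m
    ... | y , agree , weight-y = cong toℕ (trans
      (cong (_xor f x) (trans (cong (profile f) (sym weight-y))
        (trans (sym (symmetric⇒profile f-sym y)) (cert y agree))))
      (Bool.xor-same (f x)))

  -- An input that agrees with x on the bits queried on x follows the same path to the same leaf.
  evaluate-agreeing : (T : DecisionTree n) (x : Input n) → Certificate (evaluate T) x (queried T x)
  evaluate-agreeing (leaf b)            x y agree = refl
  evaluate-agreeing (query i if0 if1) x y agree = begin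
    branch (Vec.lookup y i) y ≡⟨ cong (λ b → branch b y) (agree i i∈) ⟩
    branch (Vec.lookup x i) y ≡⟨ subtree (Vec.lookup x i) (λ j j∈ → agree j (rest∈ j j∈)) ⟩
    branch (Vec.lookup x i) x ∎
    where
    open ≡-Reasoning
    branch : Bool → Input _ → Bool
    branch b z = if b then evaluate if1 z else evaluate if0 z
    rest : Bool → Subset _
    rest b = if b then queried if1 x else queried if0 x
    subtree : ∀ b → (∀ j → Vec.lookup (rest b) j ≡ true → Vec.lookup y j ≡ Vec.lookup x j) →
              branch b y ≡ branch b x
    subtree true  = evaluate-agreeing if1 x y
    subtree false = evaluate-agreeing if0 x y
    lookup-∪ : ∀ j → Vec.lookup (⁅ i ⁆ ∪ rest (Vec.lookup x i)) j ≡
                     Vec.lookup ⁅ i ⁆ j ∨ Vec.lookup (rest (Vec.lookup x i)) j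
    lookup-∪ j = Vec.lookup-zipWith _∨_ j ⁅ i ⁆ (rest (Vec.lookup x i))
    i∈ : Vec.lookup (⁅ i ⁆ ∪ rest (Vec.lookup x i)) i ≡ true
    i∈ = trans (lookup-∪ i) (cong (_∨ Vec.lookup (rest (Vec.lookup x i)) i) (Vec.[]=⇒lookup (x∈⁅x⁆ i)))
    rest∈ : ∀ j → Vec.lookup (rest (Vec.lookup x i)) j ≡ true →
            Vec.lookup (⁅ i ⁆ ∪ rest (Vec.lookup x i)) j ≡ true
    rest∈ j j∈ = trans (lookup-∪ j) (trans (cong (Vec.lookup ⁅ i ⁆ j ∨_) j∈) (Bool.∨-zeroʳ _))

  queried-certificate : {f : BooleanFunction n} (T : DecisionTree n) →
    (∀ x → evaluate T x ≡ f x) → ∀ x → Certificate f x (queried T x)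
  queried-certificate T exact x y agree =
    trans (sym (exact y)) (trans (evaluate-agreeing T x y agree) (exact x))

-- Means, influences and bias of restricted symmetric functions.

module SymmetricFunctions {a ℓ₁ ℓ₂} (K : ArchimedeanOrderedField a ℓ₁ ℓ₂) where

  open PricedQueries K
  open OrderedField K
  open Expectation K
  open BinomialSum
  open Restrictions

  private
    variable
      n : ℕ

  -- Conditioning on a free bit; this is what happens to the error probability when the bit is
  -- revealed.
  𝔼-split : ∀ (π : Restriction n) i → Vec.lookup π i ≡ nothing → (G : Input n → Carrier) →
    𝔼 (λ x → G (override x π)) ≈
    ½ * (𝔼 (λ x → G (override x (π Vec.[ i ]≔ just false))) +
         𝔼 (λ x → G (override x (π Vec.[ i ]≔ just true))))
  -- Once the first bit is fixed, the average over it is an average of two equal terms.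
  𝔼-split (nothing ∷ π) zero _ G = *-congˡ (+-cong (sym (½*2x _)) (sym (½*2x _)))
  𝔼-split (p ∷ π) (suc i) πᵢ G = trans
    (*-congˡ (+-cong
      (𝔼-split π i πᵢ (λ x → G (fromMaybe false p ∷ x)))
      (𝔼-split π i πᵢ (λ x → G (fromMaybe true p ∷ x)))))
    (solve 5 (λ h p q r s → h :* (h :* (p :+ q) :+ h :* (r :+ s)) :=
                            h :* (h :* (p :+ r) :+ h :* (q :+ s))) refl ½ _ _ _ _)

  -- The expectation of `ψ` under the binomial distribution with m fair trials. As a natural number
  -- times `½ ^ m`, it lets comparisons in the field be moved to ℕ.
  binomialMean : ℕ → (ℕ → ℕ) → Carrier
  binomialMean m ψ = fromℕ (binomialSum m ψ) * ½ ^ m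

  binomialMean-cong : ∀ m {ψ χ} → (∀ w → ψ w ≡ χ w) → binomialMean m ψ ≈ binomialMean m χ
  binomialMean-cong m eq =
    *-congʳ (reflexive (≡.cong fromℕ (binomialSum-cong m (λ w _ → eq w))))

  binomialMean-suc : ∀ m ψ → ½ * (binomialMean m ψ + binomialMean m (ψ ∘ suc)) ≈
                     binomialMean (suc m) ψ
  binomialMean-suc m ψ = trans
    (solve 4 (λ h p q s → h :* (p :* s :+ q :* s) := (p :+ q) :* (h :* s)) refl ½ _ _ _)
    (*-congʳ (sym (fromℕ-+ (binomialSum m ψ) _)))

  binomialMean-zero : ∀ m {ψ} → (∀ w → w ℕ.≤ m → ψ w ≡ 0) → binomialMean m ψ ≈ 0#
  binomialMean-zero m eq =
    trans (*-congʳ (reflexive (≡.cong fromℕ (binomialSum-zero m eq)))) (zeroˡ _)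

  binomialMean≈0⇒ : ∀ m {ψ} → binomialMean m ψ ≈ 0# → ∀ w → w ℕ.≤ m → ψ w ≡ 0
  binomialMean≈0⇒ m {ψ} eq = binomialSum≡0⇒ m (ℕ.n≤0⇒n≡0 (fromℕ-cancel-≤
    (≤-reflexive (*-cancelʳ-≈ (^-pos 0<½ m) (trans eq (sym (zeroˡ _)))))))

  indicator≈toℕ : ∀ b → indicator b ≈ fromℕ (toℕ b)
  indicator≈toℕ true  = sym (+-identityʳ 1#)
  indicator≈toℕ false = refl

  -- The fixed bits shift the weight and the free ones contribute a binomial variable.
  mean-of-weight : ∀ (π : Restriction n) (p : ℕ → Bool) →
    mean (λ x → p (weight (override x π))) ≈
    binomialMean (freeCount π) (λ w → toℕ (p (fixedWeight π ℕ.+ w)))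
  mean-of-weight [] p = trans (indicator≈toℕ (p 0)) (sym (*-identityʳ _))
  mean-of-weight (just true ∷ π) p = trans (½*2x _) (mean-of-weight π (p ∘ suc))
  mean-of-weight (just false ∷ π) p = trans (½*2x _) (mean-of-weight π p)
  mean-of-weight (nothing ∷ π) p = trans
    (*-congˡ (+-cong (mean-of-weight π p) (trans (mean-of-weight π (p ∘ suc))
      (binomialMean-cong (freeCount π) (λ w →
        ≡.cong (toℕ ∘ p) (≡.sym (ℕ.+-suc (fixedWeight π) w)))))))
    (binomialMean-suc (freeCount π) _)

  -- Given the other free bits, flipping bit j exchanges two consecutive weights. Only their order
  -- depends on bit j, and the symmetry of `q` hides it, so the value is the same for all free j.
  mean-of-weight-flip : ∀ (π : Restriction n) (j : Fin n) → Vec.lookup π j ≡ nothing →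
    (q : ℕ → ℕ → Bool) → (∀ v w → q v w ≡ q w v) → ∀ {m} → freeCount π ≡ suc m →
    mean (λ x → q (weight (override x π)) (weight (override (flip j x) π))) ≈
    binomialMean m (λ w → toℕ (q (fixedWeight π ℕ.+ w) (suc (fixedWeight π ℕ.+ w))))
  mean-of-weight-flip (nothing ∷ π) zero _ q q-sym ≡.refl = trans
    (*-congˡ (+-cong ≈-pair (trans swapped ≈-pair)))
    (½*2x _)
    where
    W = λ x → weight (override x π)
    swapped : mean (λ x → q (suc (W x)) (W x)) ≈ mean (λ x → q (W x) (suc (W x)))
    swapped = mean-cong (λ x → q-sym (suc (W x)) (W x))
    ≈-pair = mean-of-weight π (λ w → q w (suc w))
  mean-of-weight-flip (just true ∷ π) (suc j) πⱼ q q-sym eq = trans (½*2x _)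
    (mean-of-weight-flip π j πⱼ (λ v w → q (suc v) (suc w)) (λ v w → q-sym (suc v) (suc w)) eq)
  mean-of-weight-flip (just false ∷ π) (suc j) πⱼ q q-sym eq = trans (½*2x _)
    (mean-of-weight-flip π j πⱼ q q-sym eq)
  mean-of-weight-flip (nothing ∷ π) (suc j) πⱼ q q-sym {m} eq
    -- The head is free as well and is one of the m remaining trials, so m is a successor and the
    -- two cases of the head recombine by `binomialMean-suc`.
    with free-bit⇒freeCount π j πⱼ
  ... | m′ , eq′ with ≡.trans (≡.sym (ℕ.suc-injective eq)) eq′
  ... | ≡.refl = trans
    (*-congˡ (+-cong
      (mean-of-weight-flip π j πⱼ q q-sym eq′)
      (trans
        (mean-of-weight-flip π j πⱼ (λ v w → q (suc v) (suc w)) (λ v w → q-sym (suc v) (suc w)) eq′)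
        (binomialMean-cong m′ (λ w →
          ≡.cong (λ k → toℕ (q k (suc k))) (≡.sym (ℕ.+-suc (fixedWeight π) w)))))))
    (binomialMean-suc m′ _)

  open Algebra.Construct.NaturalChoice.Min totalOrder using (minOperator)
  open Algebra.Construct.NaturalChoice.MinOp minOperator using (x⊓y≤x; x⊓y≤y; ⊓-glb)

  bias≤disagreement : ∀ (g : BooleanFunction n) b → bias g ≤ disagreement g (λ _ → b)
  bias≤disagreement g false = x⊓y≤x _ _
  bias≤disagreement g true  = x⊓y≤y _ _

  module _ {f : BooleanFunction n} (f-sym : Symmetric f) (π : Restriction n) where

    private
      φ : ℕ → Bool
      φ w = profile f (fixedWeight π ℕ.+ w)

      φ-weight : ∀ x → (f ↾ π) x ≡ profile f (weight (override x π))
      φ-weight x = symmetric⇒profile f-sym (override x π)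

    disagreement-restricted : ∀ b → disagreement (f ↾ π) (λ _ → b) ≈
                              binomialMean (freeCount π) (λ w → toℕ (φ w xor b))
    disagreement-restricted b = trans
      (mean-cong (λ x → ≡.cong (_xor b) (φ-weight x)))
      (mean-of-weight π (λ w → profile f w xor b))

    Inf-free : ∀ {m} → freeCount π ≡ suc m → ∀ j → Vec.lookup π j ≡ nothing →
               Inf j (f ↾ π) ≈ binomialMean m (λ w → toℕ (φ w xor profile f (suc (fixedWeight π ℕ.+ w))))
    Inf-free eq j πⱼ = trans
      (mean-cong (λ x → ≡.cong₂ _xor_ (φ-weight x) (φ-weight (flip j x))))
      (mean-of-weight-flip π j πⱼ (λ v w → profile f v xor profile f w)
        (λ v w → Bool.xor-comm (profile f v) (profile f w)) eq)

    Inf-fixed : ∀ i {b} → Vec.lookup π i ≡ just b → Inf i (f ↾ π) ≈ 0#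
    Inf-fixed i πᵢ = trans
      (mean-cong (λ x → ≡.trans (≡.cong (λ y → (f ↾ π) x xor f y) (flip-fixed π i πᵢ x))
        (Bool.xor-same ((f ↾ π) x))))
      (𝔼-const {n} 0#)

    Inf-free-equal : ∀ i j → Vec.lookup π i ≡ nothing → Vec.lookup π j ≡ nothing →
                     Inf i (f ↾ π) ≈ Inf j (f ↾ π)
    Inf-free-equal i j πᵢ πⱼ with free-bit⇒freeCount π i πᵢ
    ... | m , eq = trans (Inf-free eq i πᵢ) (sym (Inf-free eq j πⱼ))

    constant⇒unbiased : (∀ w → w ℕ.≤ freeCount π → φ w ≡ φ 0) → bias (f ↾ π) ≤ 0#
    constant⇒unbiased constant = ≤-trans (bias≤disagreement (f ↾ π) (φ 0)) (≤-reflexive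
      (trans (disagreement-restricted (φ 0)) (binomialMean-zero (freeCount π) (λ w w≤m →
        ≡.cong toℕ (≡.trans (≡.cong (_xor φ 0) (constant w w≤m)) (Bool.xor-same (φ 0)))))))

    -- If the influence vanished, the profile would take equal values at any two consecutive
    -- reachable weights, hence be constant there, and the bias would be 0.
    Inf-free-pos : 0# < bias (f ↾ π) → ∀ j → Vec.lookup π j ≡ nothing → 0# < Inf j (f ↾ π)
    Inf-free-pos 0<bias j πⱼ = mean-nonNeg {n} _ , λ 0≈Inf →
      <⇒≱ 0<bias (constant⇒unbiased (constant 0≈Inf))
      where
      m+eq = free-bit⇒freeCount π j πⱼ
      m    = proj₁ m+eq
      eq   = proj₂ m+eq
      xor≡0⇒≡ : ∀ b b′ → toℕ (b xor b′) ≡ 0 → b′ ≡ b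
      xor≡0⇒≡ true  true  _ = ≡.refl
      xor≡0⇒≡ false false _ = ≡.refl
      step : 0# ≈ Inf j (f ↾ π) → ∀ w → w ℕ.≤ m → profile f (suc (fixedWeight π ℕ.+ w)) ≡ φ w
      step 0≈Inf w w≤m = xor≡0⇒≡ (φ w) _
        (binomialMean≈0⇒ m (trans (sym (Inf-free eq j πⱼ)) (sym 0≈Inf)) w w≤m)
      constant : 0# ≈ Inf j (f ↾ π) → ∀ w → w ℕ.≤ freeCount π → φ w ≡ φ 0
      constant 0≈Inf zero    _   = ≡.refl
      constant 0≈Inf (suc w) w<m = ≡.trans (≡.cong (profile f) (ℕ.+-suc (fixedWeight π) w))
        (≡.trans (step 0≈Inf w (ℕ.s≤s⁻¹ (≡.subst (suc w ℕ.≤_) eq w<m)))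
          (constant 0≈Inf w (ℕ.<⇒≤ w<m)))

    biased⇒free-bit : 0# < bias (f ↾ π) → ∃ λ j → Vec.lookup π j ≡ nothing
    biased⇒free-bit 0<bias with freeCount π in eq
    ... | suc m = freeCount⇒free-bit π eq
    ... | zero  = contradiction
      (constant⇒unbiased (λ w w≤m → ≡.cong φ (ℕ.n≤0⇒n≡0 (≡.subst (w ℕ.≤_) eq w≤m))))
      (<⇒≱ 0<bias)

    -- The bias is at most the disagreement with the constant `f x`, which is the binomial mean
    -- treated by `certificate-large`. Multiplying by 2 ^ l · 2 ^ m turns the inequality into one
    -- between natural numbers.
    biased⇒certificate-large : ∀ {ε} → ε < bias (f ↾ π) →
      ∀ {l} → 1 ℕ.≤ l → 1# ≤ fromℕ (2 ℕ.^ l) * ε →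
      ∀ x → Consistent π x → ∀ Q → Certificate f x Q →
      freeCount π ℕ.≤ 9 ℕ.* l ℕ.* freeCountIn Q π
    biased⇒certificate-large {ε} ε<bias {l} 1≤l 1≤2^lε x consistent Q cert =
      certificate-large f-sym π x consistent Q cert l 1≤l (fromℕ-cancel-< (begin-strict
        fromℕ (2 ℕ.^ m)                             ≈⟨ *-identityˡ _ ⟨
        1# * fromℕ (2 ℕ.^ m)                        ≤⟨ *-monoˡ-≤ (fromℕ-nonNeg (2 ℕ.^ m)) 1≤2^lε ⟩
        fromℕ (2 ℕ.^ l) * ε * fromℕ (2 ℕ.^ m)       ≈⟨ trans (*-congʳ (*-comm _ ε)) (*-assoc ε _ _) ⟩
        ε * (fromℕ (2 ℕ.^ l) * fromℕ (2 ℕ.^ m))     <⟨ *-monoˡ-< (*-pos (2^-pos l) (2^-pos m)) ε<mean ⟩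
        fromℕ S * ½ ^ m * (fromℕ (2 ℕ.^ l) * fromℕ (2 ℕ.^ m))
          ≈⟨ solve 4 (λ s h p q → s :* h :* (p :* q) := p :* s :* (h :* q)) refl _ _ _ _ ⟩
        fromℕ (2 ℕ.^ l) * fromℕ S * (½ ^ m * fromℕ (2 ℕ.^ m))
          ≈⟨ trans (*-congˡ (½^m*2^m≈1 m)) (*-identityʳ _) ⟩
        fromℕ (2 ℕ.^ l) * fromℕ S                   ≈⟨ fromℕ-* (2 ℕ.^ l) S ⟨
        fromℕ (2 ℕ.^ l ℕ.* S)                       ∎))
      where
      open ≤-Reasoning
      m = freeCount π
      S = binomialSum m (λ w → toℕ (φ w xor f x))
      2^-pos : ∀ k → 0# < fromℕ (2 ℕ.^ k)
      2^-pos k = <-≤-trans (0<fromℕsuc 0) (fromℕ-mono (ℕ.m^n>0 2 k))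
      ε<mean : ε < fromℕ S * ½ ^ m
      ε<mean = <-≤-trans ε<bias (≤-trans (bias≤disagreement (f ↾ π) (f x))
        (≤-reflexive (disagreement-restricted (f x))))

  disagreement-comm : ∀ (g h : BooleanFunction n) → disagreement g h ≈ disagreement h g
  disagreement-comm g h = mean-cong (λ x → Bool.xor-comm (g x) (h x))

  -- Exactly one of the two constants is wrong on each input. The total 1 appears as `½ + ½` so that
  -- one `½` can be cancelled when the halves are compared.
  disagreement-false+true : ∀ (g : BooleanFunction n) →
    disagreement g (λ _ → false) + disagreement g (λ _ → true) ≈ ½ + ½
  disagreement-false+true {n} g = trans
    (sym (𝔼-+ (λ x → indicator (g x xor false)) (λ x → indicator (g x xor true))))
    (trans (𝔼-cong (λ x → complementary (g x))) (trans (𝔼-const {n} 1#) (sym ½+½≈1)))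
    where
    complementary : ∀ b → indicator (b xor false) + indicator (b xor true) ≈ 1#
    complementary true  = +-identityʳ 1#
    complementary false = +-identityˡ 1#
    ½+½≈1 : ½ + ½ ≈ 1#
    ½+½≈1 = trans (sym (trans (distribˡ ½ 1# 1#) (+-cong (*-identityʳ ½) (*-identityʳ ½))))
      (½*2x 1#)

  -- Rounding the mean selects the constant with the smaller disagreement. This bounds the error at
  -- a halting transcript.
  disagreement-majority : ∀ (g : BooleanFunction n) →
    disagreement (λ _ → does (½ ≤? mean g)) g ≤ bias g
  disagreement-majority {n} g with ½ ≤? mean g
  ... | yes ½≤E = ≤-respˡ-≈ (disagreement-comm g (λ _ → true)) (⊓-glb D₁≤D₀ ≤-refl)
    where
    ½≤D₀ : ½ ≤ disagreement g (λ _ → false)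
    ½≤D₀ = ≤-respʳ-≈ (mean-cong (λ x → ≡.sym (Bool.xor-identityʳ (g x)))) ½≤E
    D₁≤D₀ : disagreement g (λ _ → true) ≤ disagreement g (λ _ → false)
    D₁≤D₀ = ≤-trans (+-cancelʳ-≤ ½ (≤-trans (+-monoʳ-≤ _ ½≤D₀)
      (≤-reflexive (trans (+-comm _ _) (disagreement-false+true g))))) ½≤D₀
  ... | no ½≰E = ≤-respˡ-≈ (disagreement-comm g (λ _ → false)) (⊓-glb ≤-refl D₀≤D₁)
    where
    D₀≤½ : disagreement g (λ _ → false) ≤ ½
    D₀≤½ = ≤-respˡ-≈ (mean-cong (λ x → ≡.sym (Bool.xor-identityʳ (g x)))) (proj₁ (≰⇒> ½≰E))
    D₀≤D₁ : disagreement g (λ _ → false) ≤ disagreement g (λ _ → true)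
    D₀≤D₁ = ≤-trans D₀≤½ (+-cancelʳ-≤ ½ (≤-trans
      (≤-reflexive (trans (sym (disagreement-false+true g)) (+-comm _ _))) (+-monoʳ-≤ _ D₀≤½)))

-- Comparison of the scores.

module Greedy {a ℓ₁ ℓ₂} (K : ArchimedeanOrderedField a ℓ₁ ℓ₂)
              {n : ℕ} (β : PricedQueries.Carrier K) where

  open PricedQueries K
  open OrderedField K
  open Expectation K
  open Online {n} β
  open AddSupremum _≤_ using ([_])

  module _ (g : BooleanFunction n) (θ : Vector Carrier n) where

    -- Quotients with a common positive numerator are ordered inversely to their denominators. The
    -- value +∞ fits in: it arises at θ = 0, the least possible investment.
    score-cancel : ∀ i j → Inf i g ≈ Inf j g → 0# < Inf j g → 0# ≤ θ i → 0# ≤ θ j →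
                   score g θ j ≤⁺ score g θ i → θ i ≤ θ j
    score-cancel i j Infᵢ≈Infⱼ 0<Infⱼ 0≤θᵢ 0≤θⱼ
      with θ i ≟ 0# | Inf i g ≟ 0# | θ j ≟ 0# | Inf j g ≟ 0#
    ... | yes θᵢ≈0 | _ | _ | _ = λ _ → ≤-trans (≤-reflexive θᵢ≈0) 0≤θⱼ
    ... | no _ | _ | yes _ | yes Infⱼ≈0 = contradiction Infⱼ≈0 (>⇒≉0 0<Infⱼ)
    ... | no _ | _ | yes _ | no _ = λ ()
    ... | no θᵢ≉0 | _ | no θⱼ≉0 | _ = λ { [ p ] → *-cancelʳ-≤ 0<Infⱼ (begin
      θ i * Inf j g                        ≈⟨ *-congˡ (*-inverse-cancelʳ′ 0<θⱼ (Inf j g)) ⟨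
      θ i * (Inf j g * θ j ⁻¹ * θ j)       ≤⟨ *-monoʳ-≤ 0≤θᵢ (*-monoˡ-≤ 0≤θⱼ p) ⟩
      θ i * (Inf i g * θ i ⁻¹ * θ j)       ≈⟨ solve 4 (λ t s r u → t :* (s :* r :* u) := u :* (s :* r :* t)) refl (θ i) (Inf i g) (θ i ⁻¹) (θ j) ⟩
      θ j * (Inf i g * θ i ⁻¹ * θ i)       ≈⟨ *-congˡ (*-inverse-cancelʳ′ 0<θᵢ (Inf i g)) ⟩
      θ j * Inf i g                        ≈⟨ *-congˡ Infᵢ≈Infⱼ ⟩
      θ j * Inf j g                        ∎) }
      where
      open ≤-Reasoning
      0<θᵢ : 0# < θ i
      0<θᵢ = 0≤θᵢ , θᵢ≉0 ∘ sym
      0<θⱼ : 0# < θ j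
      0<θⱼ = 0≤θⱼ , θⱼ≉0 ∘ sym

    -- Influence 0 gives score 0, also when θ = 0, by the convention 0 / 0 = 0; positive influence
    -- gives a positive or infinite score. Hence a fixed bit is never chosen while some free bit has
    -- influence.
    score-pos : ∀ i j → Inf i g ≈ 0# → 0# < Inf j g → 0# ≤ θ j →
                ¬ (score g θ j ≤⁺ score g θ i)
    score-pos i j Infᵢ≈0 0<Infⱼ 0≤θⱼ
      with θ i ≟ 0# | Inf i g ≟ 0# | θ j ≟ 0# | Inf j g ≟ 0#
    ... | _ | no Infᵢ≉0 | _ | _ = contradiction Infᵢ≈0 Infᵢ≉0
    ... | _ | _ | _ | yes Infⱼ≈0 = contradiction Infⱼ≈0 (>⇒≉0 0<Infⱼ)
    ... | yes _ | yes _ | yes _ | no _ = λ ()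
    ... | no _ | yes _ | yes _ | no _ = λ ()
    ... | yes _ | yes _ | no θⱼ≉0 | no _ = λ { [ p ] →
      <⇒≱ (*-pos 0<Infⱼ (⁻¹-pos (0≤θⱼ , θⱼ≉0 ∘ sym))) p }
    ... | no _ | yes _ | no θⱼ≉0 | no _ = λ { [ p ] →
      <⇒≱ (*-pos 0<Infⱼ (⁻¹-pos (0≤θⱼ , θⱼ≉0 ∘ sym)))
        (≤-trans p (≤-reflexive (trans (*-congʳ Infᵢ≈0) (zeroˡ _)))) }

-- Analysis of Warmup-IPRR.

module OnlineAnalysis {a ℓ₁ ℓ₂} (K : ArchimedeanOrderedField a ℓ₁ ℓ₂) where

  open PricedQueries K
  open OrderedField K
  open Expectation K
  open SymmetricFunctions K
  open Restrictions
  open Algebra.Properties.Semiring.Sum semiring using (sum-cong-≋)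

  -- The integer `l` stands for the logarithm of 1/ε, rounded up; the analysis uses only that 2 ^ l
  -- ≥ 1/ε and l ≥ 1.
  module WarmupIPRR
    {n : ℕ} (f : BooleanFunction n) (f-sym : Symmetric f)
    (c : Vector Carrier n) (0≤c : ∀ i → 0# ≤ c i)
    (ε β : Carrier) (0<ε : 0# < ε) (0<β : 0# < β)
    (pick : Online.TieBreaking {n} β f ε)
    (l : ℕ) (1≤l : 1 ℕ.≤ l) (1≤2^lε : 1# ≤ fromℕ (2 ℕ.^ l) * ε)
    where

    open Online {n} β
    open Greedy K {n} β

    A : OnlineAlgorithm n
    A = warmupIPRR f ε pick

    -- The investments in units of β, so that levels are compared in ℕ.
    counts : Transcript n → Vector ℕ n
    counts []            = λ _ → 0
    counts ((i , _) ∷ h) = Functional.updateAt (counts h) i suc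

    investments≈ : ∀ h j → investments h j ≈ fromℕ (counts h j) * β
    investments≈ [] j = sym (zeroˡ β)
    investments≈ ((i , _) ∷ h) j with j Fin.≟ i
    ... | no j≢i = trans (reflexive (Functional.updateAt-minimal j i (investments h) j≢i))
      (trans (investments≈ h j)
        (*-congʳ (reflexive (≡.cong fromℕ (≡.sym (Functional.updateAt-minimal j i (counts h) j≢i))))))
    ... | yes ≡.refl = trans (reflexive (Functional.updateAt-updates j (investments h)))
      (trans (+-congʳ (investments≈ h j))
      (trans (solve 2 (λ k b → k :* b :+ b := (con 1 :+ k) :* b) refl _ β)
        (*-congʳ (reflexive (≡.cong fromℕ (≡.sym (Functional.updateAt-updates j (counts h))))))))

    investments-nonNeg : ∀ h j → 0# ≤ investments h j
    investments-nonNeg h j = ≤-respʳ-≈ (sym (investments≈ h j))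
      (*-nonNeg (fromℕ-nonNeg (counts h j)) (proj₁ 0<β))

    Free : Transcript n → Fin n → Set
    Free h i = Vec.lookup (known h) i ≡ nothing

    Least : Transcript n → Fin n → Set
    Least h i = ∀ j → Free h j → counts h i ℕ.≤ counts h j

    -- A biased restriction has a free bit of positive influence, which rules out the fixed bits,
    -- whose influence is 0. The free bits share one influence, so among them a largest score means
    -- a smallest investment.
    argmax-free-least : ∀ h → ε < bias (f ↾ known h) → ∀ i →
      IsArgMax (score (f ↾ known h) (investments h)) i → Free h i × Least h i
    argmax-free-least h ε<bias i max = i-free , i-least
      where
      g = f ↾ known h
      0<bias : 0# < bias g
      0<bias = ≤-<-trans (proj₁ 0<ε) ε<bias
      Inf-pos : ∀ j → Free h j → 0# < Inf j g
      Inf-pos = Inf-free-pos f-sym (known h) 0<bias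
      i-free : Free h i
      i-free with Vec.lookup (known h) i in πᵢ | biased⇒free-bit f-sym (known h) 0<bias
      ... | nothing | _ = ≡.refl
      ... | just _  | j , j-free = contradiction (max j)
        (score-pos g (investments h) i j (Inf-fixed f-sym (known h) i πᵢ) (Inf-pos j j-free)
          (investments-nonNeg h j))
      i-least : Least h i
      i-least j j-free = fromℕ-cancel-≤ (*-cancelʳ-≤ 0<β
        (≤-respˡ-≈ (investments≈ h i) (≤-respʳ-≈ (investments≈ h j)
          (score-cancel g (investments h) i j
            (Inf-free-equal f-sym (known h) i j i-free j-free) (Inf-pos j j-free)
            (investments-nonNeg h i) (investments-nonNeg h j) (max j)))))

    -- Charging the completed levels.

    N : ℕ
    N = 9 ℕ.* l

    sumIn : Vec Bool n → Vector ℕ n → ℕ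
    sumIn Q e = ℕ-Sum.sum (λ i → if Vec.lookup Q i then e i else 0)

    -- The free bits all stand at the level P or P + 1, and e i levels have been
    -- charged to bit i: the completed levels at which it was still free.  Every
    -- certificate meets each completed level in a 1 / N fraction of its bits.
    record Invariant (h : Transcript n) : Set ℓ₂ where
      field
        P           : ℕ
        e           : Vector ℕ n
        e≤c         : ∀ i → fromℕ (e i) * β ≤ c i
        counts≤     : ∀ i → counts h i ℕ.≤ suc (e i)
        free-e      : ∀ i → Free h i → e i ≡ P
        free-counts : ∀ i → Free h i → counts h i ≡ P ⊎ counts h i ≡ suc P
        unseen      : ∀ i → Free h i → fromℕ (counts h i) * β ≤ c i
        competitive : ∀ x → Consistent (known h) x → ∀ Q → Certificate f x Q →
                      ℕ-Sum.sum e ℕ.≤ N ℕ.* sumIn Q e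

    open Invariant

    -- A least free bit at level P + 1 shows that no free bit is left at level P. The level is
    -- complete, and each bit still free is charged for it: having stayed hidden after P + 1
    -- increments, it can afford the charge. The certificate inequality for the current `π` is added
    -- to `competitive`.
    next-level : ∀ {h} (I : Invariant h) → ε < bias (f ↾ known h) →
                 ∀ i → Free h i → Least h i → counts h i ≡ suc (P I) →
                 Σ (Invariant h) λ I′ → counts h i ≡ P I′
    next-level {h} I ε<bias i i-free i-least kᵢ≡ = record
      { P           = suc (P I)
      ; e           = e′
      ; e≤c         = e′≤c
      ; counts≤     = λ j → ℕ.≤-trans (counts≤ I j) (ℕ.s≤s (ℕ.m≤n+m (e I j) _))
      ; free-e      = free-e′
      ; free-counts = λ j j-free → inj₁ (free-counts′ j j-free)
      ; unseen      = unseen I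
      ; competitive = competitive′
      } , kᵢ≡
      where
      π = known h
      e′ : Vector ℕ n
      e′ j = free (Vec.lookup π j) ℕ.+ e I j
      free-e′ : ∀ j → Free h j → e′ j ≡ suc (P I)
      free-e′ j j-free = ≡.cong₂ ℕ._+_ (≡.cong free j-free) (free-e I j j-free)
      free-counts′ : ∀ j → Free h j → counts h j ≡ suc (P I)
      free-counts′ j j-free with free-counts I j j-free
      ... | inj₂ kⱼ≡ = kⱼ≡
      ... | inj₁ kⱼ≡ = contradiction (≡.subst₂ ℕ._≤_ kᵢ≡ kⱼ≡ (i-least j j-free)) ℕ.1+n≰n
      e′≤c : ∀ j → fromℕ (e′ j) * β ≤ c j
      e′≤c j with Vec.lookup π j in πⱼ
      ... | just _  = e≤c I j
      ... | nothing = ≡.subst (λ k → fromℕ k * β ≤ c j)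
        (≡.trans (free-counts′ j πⱼ) (≡.cong suc (≡.sym (free-e I j πⱼ)))) (unseen I j πⱼ)
      competitive′ : ∀ x → Consistent π x → ∀ Q → Certificate f x Q →
                     ℕ-Sum.sum e′ ℕ.≤ N ℕ.* sumIn Q e′
      competitive′ x consistent Q cert = begin
        ℕ-Sum.sum e′
          ≡⟨ ℕ-Sum.∑-distrib-+ (λ j → free (Vec.lookup π j)) (e I) ⟩
        freeCount π ℕ.+ ℕ-Sum.sum (e I)
          ≤⟨ ℕ.+-mono-≤
               (biased⇒certificate-large f-sym π ε<bias 1≤l 1≤2^lε x consistent Q cert)
               (competitive I x consistent Q cert) ⟩
        N ℕ.* freeCountIn Q π ℕ.+ N ℕ.* sumIn Q (e I)
          ≡⟨ ℕ.*-distribˡ-+ N (freeCountIn Q π) (sumIn Q (e I)) ⟨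
        N ℕ.* (freeCountIn Q π ℕ.+ sumIn Q (e I))
          ≡⟨ ≡.cong (N ℕ.*_) (ℕ-Sum.∑-distrib-+ {n} _ _) ⟨
        N ℕ.* ℕ-Sum.sum (λ j → (if Vec.lookup Q j then free (Vec.lookup π j) else 0) ℕ.+
                               (if Vec.lookup Q j then e I j else 0))
          ≡⟨ ≡.cong (N ℕ.*_) (ℕ-Sum.sum-cong-≗ (λ j → if-+ (Vec.lookup Q j))) ⟩
        N ℕ.* sumIn Q e′ ∎
        where
        open ℕ.≤-Reasoning
        if-+ : ∀ q {u v} → (if q then u else 0) ℕ.+ (if q then v else 0) ≡ (if q then u ℕ.+ v else 0)
        if-+ true  = ≡.refl
        if-+ false = ≡.refl

    at-level : ∀ {h} → Invariant h → ε < bias (f ↾ known h) → ∀ i → Free h i → Least h i →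
               Σ (Invariant h) λ I → counts h i ≡ P I
    at-level I ε<bias i i-free i-least with free-counts I i i-free
    ... | inj₁ kᵢ≡ = I , kᵢ≡
    ... | inj₂ kᵢ≡ = next-level I ε<bias i i-free i-least kᵢ≡

    module _ {h} (I : Invariant h) (i : Fin n) (i-free : Free h i) (kᵢ≡ : counts h i ≡ P I) where

      private
        kᵢ′≡ : Functional.updateAt (counts h) i suc i ≡ suc (P I)
        kᵢ′≡ = ≡.trans (Functional.updateAt-updates i (counts h)) (≡.cong suc kᵢ≡)
        kⱼ′≡ : ∀ j → j ≢ i → Functional.updateAt (counts h) i suc j ≡ counts h j
        kⱼ′≡ j j≢i = Functional.updateAt-minimal j i (counts h) j≢i

        counts≤′ : ∀ j → Functional.updateAt (counts h) i suc j ℕ.≤ suc (e I j)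
        counts≤′ j with j Fin.≟ i
        ... | no j≢i     = ≡.subst (ℕ._≤ _) (≡.sym (kⱼ′≡ j j≢i)) (counts≤ I j)
        ... | yes ≡.refl = ℕ.≤-reflexive (≡.trans kᵢ′≡ (≡.cong suc (≡.sym (free-e I j i-free))))

      invest-unseen : ¬ (c i ≤ investments ((i , nothing) ∷ h) i) → Invariant ((i , nothing) ∷ h)
      invest-unseen cᵢ≰ = record
        { P           = P I
        ; e           = e I
        ; e≤c         = e≤c I
        ; counts≤     = counts≤′
        ; free-e      = free-e I
        ; free-counts = free-counts′
        ; unseen      = unseen′
        ; competitive = competitive I
        }
        where
        free-counts′ : ∀ j → Free h j → _
        free-counts′ j j-free with j Fin.≟ i
        ... | no j≢i     = ≡.subst (λ k → k ≡ P I ⊎ k ≡ suc (P I)) (≡.sym (kⱼ′≡ j j≢i)) (free-counts I j j-free)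
        ... | yes ≡.refl = inj₂ kᵢ′≡
        unseen′ : ∀ j → Free h j → fromℕ (Functional.updateAt (counts h) i suc j) * β ≤ c j
        unseen′ j j-free with j Fin.≟ i
        ... | no j≢i     = ≡.subst (λ k → fromℕ k * β ≤ c j) (≡.sym (kⱼ′≡ j j≢i)) (unseen I j j-free)
        -- The bit stayed hidden, so its cost exceeds even the raised investment.
        ... | yes ≡.refl = ≤-respˡ-≈ (investments≈ ((j , nothing) ∷ h) j) (proj₁ (≰⇒> cᵢ≰))

      invest-seen : ∀ b → Invariant ((i , just b) ∷ h)
      invest-seen b = record
        { P           = P I
        ; e           = e I
        ; e≤c         = e≤c I
        ; counts≤     = counts≤′
        ; free-e      = λ j j-free → free-e I j (proj₂ (free⇒ j j-free))
        ; free-counts = λ j j-free → let j≢i , j-free₀ = free⇒ j j-free in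
            ≡.subst (λ k → k ≡ P I ⊎ k ≡ suc (P I)) (≡.sym (kⱼ′≡ j j≢i)) (free-counts I j j-free₀)
        ; unseen      = λ j j-free → let j≢i , j-free₀ = free⇒ j j-free in
            ≡.subst (λ k → fromℕ k * β ≤ c j) (≡.sym (kⱼ′≡ j j≢i)) (unseen I j j-free₀)
        -- Revealing a bit only shrinks the set of consistent inputs, so the inequality is
        -- inherited.
        ; competitive = λ x consistent → competitive I x (consistent⇒ x consistent)
        }
        where
        π = known h
        free⇒ : ∀ j → Free ((i , just b) ∷ h) j → j ≢ i × Free h j
        free⇒ j j-free with j Fin.≟ i
        ... | no j≢i     = j≢i , ≡.trans (≡.sym (Vec.lookup∘updateAt′ j i j≢i π)) j-free
        ... | yes ≡.refl with ≡.trans (≡.sym (Vec.lookup∘updateAt j π)) j-free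
        ...   | ()
        consistent⇒ : ∀ x → Consistent (π Vec.[ i ]≔ just b) x → Consistent π x
        consistent⇒ x consistent j πⱼ with j Fin.≟ i
        ... | no j≢i     = consistent j (≡.trans (Vec.lookup∘updateAt′ j i j≢i π) πⱼ)
        ... | yes ≡.refl with ≡.trans (≡.sym i-free) πⱼ
        ...   | ()

    -- Executions, arranged as a tree.

    halts : ∀ h → ¬ (ε < bias (f ↾ known h)) → A h ≡ halt (does (½ ≤? mean (f ↾ known h)))
    halts h ε≮bias with ε <? bias (f ↾ known h)
    ... | yes ε<bias = contradiction ε<bias ε≮bias
    ... | no _       = ≡.refl

    invests : ∀ h → ε < bias (f ↾ known h) → ∃ λ i → A h ≡ invest i × Free h i × Least h i
    invests h ε<bias with ε <? bias (f ↾ known h)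
    ... | yes p = _ , ≡.refl , argmax-free-least h p _ (proj₂ (pick h p))
    ... | no ε≮bias = contradiction ε<bias ε≮bias

    -- The executions on all inputs at once, branching where a bit becomes visible. A leaf gathers
    -- all inputs consistent with its restriction, so its error is a conditional probability;
    -- separate runs for each input would not show this.
    data Computation : Transcript n → Set ℓ₂ where
      stop  : ∀ {h b} → Invariant h → A h ≡ halt b →
              disagreement (λ _ → b) (f ↾ known h) ≤ ε → Computation h
      blind : ∀ {h i} → A h ≡ invest i → ¬ (c i ≤ investments ((i , nothing) ∷ h) i) →
              Computation ((i , nothing) ∷ h) → Computation h
      seen  : ∀ {h i} → A h ≡ invest i → c i ≤ investments ((i , nothing) ∷ h) i → Free h i →
              (∀ b → Computation ((i , just b) ∷ h)) → Computation h

    result : ∀ {h} → Computation h → Input n → Transcript n × Bool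
    result (stop {h} {b} _ _ _)      x = h , b
    result (blind _ _ t)             x = result t x
    result (seen {i = i} _ _ _ next) x = result (next (Vec.lookup x i)) x

    extend-blind : ∀ h i → ¬ (c i ≤ investments ((i , nothing) ∷ h) i) →
                   ∀ x → extend c x h i ≡ (i , nothing) ∷ h
    extend-blind h i cᵢ≰ x with c i ≤? investments ((i , nothing) ∷ h) i
    ... | yes cᵢ≤ = contradiction cᵢ≤ cᵢ≰
    ... | no _    = ≡.refl

    extend-seen : ∀ h i → c i ≤ investments ((i , nothing) ∷ h) i →
                  ∀ x → extend c x h i ≡ (i , just (Vec.lookup x i)) ∷ h
    extend-seen h i cᵢ≤ x with c i ≤? investments ((i , nothing) ∷ h) i
    ... | yes _   = ≡.refl
    ... | no cᵢ≰  = contradiction cᵢ≤ cᵢ≰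

    result-run : ∀ {h} (t : Computation h) x →
                 Run A c x h (proj₁ (result t x)) (proj₂ (result t x))
    result-run (stop _ Ah≡ _) x = halted Ah≡
    result-run {h} (blind {i = i} Ah≡ cᵢ≰ t) x = invested Ah≡
      (≡.subst (λ h′ → Run A c x h′ (proj₁ r) (proj₂ r)) (≡.sym (extend-blind h i cᵢ≰ x))
        (result-run t x))
      where r = result t x
    result-run {h} (seen {i = i} Ah≡ cᵢ≤ _ next) x = invested Ah≡
      (≡.subst (λ h′ → Run A c x h′ (proj₁ r) (proj₂ r)) (≡.sym (extend-seen h i cᵢ≤ x))
        (result-run (next (Vec.lookup x i)) x))
      where r = result (next (Vec.lookup x i)) x

    result-invariant : ∀ {h} (t : Computation h) x → Consistent (known h) x →
      Invariant (proj₁ (result t x)) × Consistent (known (proj₁ (result t x))) x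
    result-invariant (stop I _ _)  x consistent = I , consistent
    result-invariant (blind _ _ t) x consistent = result-invariant t x consistent
    result-invariant {h} (seen {i = i} _ _ _ next) x consistent =
      result-invariant (next (Vec.lookup x i)) x consistent′
      where
      consistent′ : Consistent (known h Vec.[ i ]≔ just (Vec.lookup x i)) x
      consistent′ j eq with j Fin.≟ i
      ... | no j≢i = consistent j (≡.trans (≡.sym (Vec.lookup∘updateAt′ j i j≢i (known h))) eq)
      ... | yes ≡.refl with ≡.trans (≡.sym (Vec.lookup∘updateAt j (known h))) eq
      ...   | ≡.refl = ≡.refl

    -- The mean over overridden inputs is the error probability conditioned on the known bits. It is
    -- at most ε at each leaf, and a revealed bit averages two branches.
    result-error : ∀ {h} (t : Computation h) →
      mean (λ x → proj₂ (result t (override x (known h))) xor f (override x (known h))) ≤ ε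
    result-error (stop _ _ error)  = error
    result-error (blind _ _ t)     = result-error t
    result-error {h} (seen {i = i} _ _ i-free next) = begin
      mean (λ x → wrong (override x π))
        ≈⟨ 𝔼-split π i i-free (indicator ∘ wrong) ⟩
      ½ * (mean (λ x → wrong (override x (π Vec.[ i ]≔ just false))) +
           mean (λ x → wrong (override x (π Vec.[ i ]≔ just true))))
        ≤⟨ *-monoʳ-≤ (proj₁ 0<½) (+-mono-≤ (branch false) (branch true)) ⟩
      ½ * (ε + ε)
        ≈⟨ ½*2x ε ⟩
      ε ∎
      where
      open ≤-Reasoning
      π = known h
      wrong : BooleanFunction n
      wrong x = proj₂ (result (next (Vec.lookup x i)) x) xor f x
      branch : ∀ b → mean (λ x → wrong (override x (π Vec.[ i ]≔ just b))) ≤ ε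
      -- On inputs overridden by `π′` bit i equals b, so the computation continues in branch b.
      branch b = ≤-respˡ-≈ (mean-cong (λ x →
        ≡.cong (λ b′ → proj₂ (result (next b′) (override x π′)) xor f (override x π′))
          (≡.sym (override-consistent π′ x i (Vec.lookup∘updateAt i π)))))
        (result-error (next b))
        where
        π′ = π Vec.[ i ]≔ just b

    sum-counts-suc : ∀ {m} (k : Vector ℕ m) i →
                     ℕ-Sum.sum (Functional.updateAt k i suc) ≡ suc (ℕ-Sum.sum k)
    sum-counts-suc k zero    = ≡.refl
    sum-counts-suc k (suc i) =
      ≡.trans (≡.cong (k zero ℕ.+_) (sum-counts-suc (k ∘ suc) i)) (ℕ.+-suc (k zero) _)

    -- The costs, hence the investments, are bounded, so the fuel runs out only
    -- after the algorithm has halted.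
    compute : ∀ H → (∀ i → c i ≤ fromℕ H * β) → ∀ fuel {h} → Invariant h →
              n ℕ.* suc H ℕ.< ℕ-Sum.sum (counts h) ℕ.+ fuel → Computation h
    compute H c≤H fuel {h} I enough with ε <? bias (f ↾ known h)
    ... | no ε≮bias = stop I (halts h ε≮bias)
      (≤-trans (disagreement-majority (f ↾ known h)) (≮⇒≥ ε≮bias))
    -- Every increment moves one unit from `fuel` to the counts. From `counts` ≤ 1 + e and e β ≤ c ≤
    -- H β, the counts sum to at most n (H + 1), so the fuel cannot be spent while the bias exceeds
    -- ε.
    compute H c≤H zero {h} I enough | yes _ = contradiction
      (sum≤ (counts h) counts≤H)
      (ℕ.<⇒≱ (≡.subst (n ℕ.* suc H ℕ.<_) (ℕ.+-identityʳ _) enough))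
      where
      counts≤H : ∀ i → counts h i ℕ.≤ suc H
      counts≤H i = ℕ.≤-trans (counts≤ I i)
        (ℕ.s≤s (fromℕ-cancel-≤ (*-cancelʳ-≤ 0<β (≤-trans (e≤c I i) (c≤H i)))))
      sum≤ : ∀ {m} (k : Vector ℕ m) → (∀ i → k i ℕ.≤ suc H) → ℕ-Sum.sum k ℕ.≤ m ℕ.* suc H
      sum≤ {zero}  k k≤ = ℕ.z≤n
      sum≤ {suc m} k k≤ = ℕ.+-mono-≤ (k≤ zero) (sum≤ (k ∘ suc) (k≤ ∘ suc))
    compute H c≤H (suc fuel) {h} I enough | yes ε<bias with invests h ε<bias
    ... | i , Ah≡ , i-free , i-least
      with at-level I ε<bias i i-free i-least | c i ≤? investments ((i , nothing) ∷ h) i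
    ... | I′ , kᵢ≡ | yes cᵢ≤ = seen Ah≡ cᵢ≤ i-free (λ b →
      compute H c≤H fuel (invest-seen I′ i i-free kᵢ≡ b) (enough′ (just b)))
      where
      enough′ : ∀ v → n ℕ.* suc H ℕ.< ℕ-Sum.sum (counts ((i , v) ∷ h)) ℕ.+ fuel
      enough′ v = ≡.subst (n ℕ.* suc H ℕ.<_) (≡.trans (ℕ.+-suc _ fuel)
        (≡.cong (ℕ._+ fuel) (≡.sym (sum-counts-suc (counts h) i)))) enough
    ... | I′ , kᵢ≡ | no cᵢ≰ = blind Ah≡ cᵢ≰
      (compute H c≤H fuel (invest-unseen I′ i i-free kᵢ≡ cᵢ≰)
        (≡.subst (n ℕ.* suc H ℕ.<_) (≡.trans (ℕ.+-suc _ fuel)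
          (≡.cong (ℕ._+ fuel) (≡.sym (sum-counts-suc (counts h) i)))) enough))

    initial : Invariant []
    initial = record
      { P           = 0
      ; e           = λ _ → 0
      ; e≤c         = λ i → ≤-respˡ-≈ (sym (zeroˡ β)) (0≤c i)
      ; counts≤     = λ _ → ℕ.z≤n
      ; free-e      = λ _ _ → ≡.refl
      ; free-counts = λ _ _ → inj₁ ≡.refl
      ; unseen      = λ i _ → ≤-respˡ-≈ (sym (zeroˡ β)) (0≤c i)
      ; competitive = λ _ _ Q _ →
          ≡.subst (ℕ._≤ N ℕ.* sumIn Q (λ _ → 0)) (≡.sym (ℕ-Sum.sum-replicate-zero n)) ℕ.z≤n
      }

    computation : Computation []
    computation = compute H c≤H (suc (n ℕ.* suc H)) initial (ℕ.m≤n+m _ (ℕ-Sum.sum {n} (λ _ → 0)))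
      where
      -- One bound for all bits, since the sum dominates every single cost.
      H = proj₁ (archimedean (sum c * β ⁻¹))
      single≤sum : ∀ {m} (v : Vector Carrier m) → (∀ i → 0# ≤ v i) → ∀ i → v i ≤ sum v
      single≤sum v 0≤v zero    = ≤-respˡ-≈ (+-identityʳ _) (+-monoʳ-≤ _ (sum-nonNeg (0≤v ∘ suc)))
      single≤sum v 0≤v (suc i) = ≤-trans (single≤sum (v ∘ suc) (0≤v ∘ suc) i)
        (≤-respˡ-≈ (+-identityˡ _) (+-monoˡ-≤ _ (0≤v zero)))
      c≤H : ∀ i → c i ≤ fromℕ H * β
      c≤H i = ≤-trans (single≤sum c 0≤c i) (≤-respˡ-≈ (*-inverse-cancelʳ′ 0<β (sum c))
        (*-monoˡ-≤ (proj₁ 0<β) (proj₂ (archimedean (sum c * β ⁻¹)))))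

    []-consistent : ∀ x → Consistent (known {n} []) x
    []-consistent x i eq with ≡.trans (≡.sym (Vec.lookup-replicate i nothing)) eq
    ... | ()

    terminates : Terminates A c
    terminates x = record { run = result-run computation x }

    outputs-error : ErrorAtMost ε f (outputs terminates)
    outputs-error = ≤-respˡ-≈
      (mean-cong (λ x → ≡.cong (λ y → proj₂ (result computation y) xor f y)
        (consistent⇒override (known []) x ([]-consistent x))))
      (result-error computation)

    -- The expected cost against the offline optimum.

    fromℕ-sum : ∀ {m} (k : Vector ℕ m) → fromℕ (ℕ-Sum.sum k) * β ≈ sum (λ i → fromℕ (k i) * β)
    fromℕ-sum {zero}  k = zeroˡ β
    fromℕ-sum {suc m} k = trans (*-congʳ (fromℕ-+ (k zero) _))
      (trans (distribʳ β _ _) (+-congˡ (fromℕ-sum (k ∘ suc))))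

    -- The one increment per bit that escapes the charge sums to β n. The charges sum to at most N
    -- times those inside `Q`, and no bit is charged more than its cost.
    totalInvestment-bound : ∀ {h} → Invariant h → ∀ x → Consistent (known h) x →
      ∀ Q → Certificate f x Q →
      totalInvestment h ≤ β * fromℕ n + fromℕ N * sum (λ i → if Vec.lookup Q i then c i else 0#)
    totalInvestment-bound {h} I x consistent Q cert = begin
      totalInvestment h
        ≈⟨ sum-cong-≋ (investments≈ h) ⟩
      sum (λ i → fromℕ (counts h i) * β)
        ≈⟨ fromℕ-sum (counts h) ⟨
      fromℕ (ℕ-Sum.sum (counts h)) * β
        ≤⟨ *-monoˡ-≤ (proj₁ 0<β) (fromℕ-mono (ℕ.≤-trans (sum≤ (counts h) (e I) (counts≤ I))
             (ℕ.+-monoʳ-≤ n (competitive I x consistent Q cert)))) ⟩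
      fromℕ (n ℕ.+ N ℕ.* sumIn Q (e I)) * β
        ≈⟨ *-congʳ (trans (fromℕ-+ n _) (+-congˡ (fromℕ-* N _))) ⟩
      (fromℕ n + fromℕ N * fromℕ (sumIn Q (e I))) * β
        ≈⟨ solve 4 (λ m k s b → (m :+ k :* s) :* b := b :* m :+ k :* (s :* b)) refl _ _ _ β ⟩
      β * fromℕ n + fromℕ N * (fromℕ (sumIn Q (e I)) * β)
        ≤⟨ +-monoʳ-≤ _ (*-monoʳ-≤ (fromℕ-nonNeg N) (≤-respˡ-≈ (sym (fromℕ-sum {n} _))
             (sum-mono (λ i → charged i (Vec.lookup Q i))))) ⟩
      β * fromℕ n + fromℕ N * sum (λ i → if Vec.lookup Q i then c i else 0#) ∎
      where
      open ≤-Reasoning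
      sum≤ : ∀ {m} (k v : Vector ℕ m) → (∀ i → k i ℕ.≤ suc (v i)) →
             ℕ-Sum.sum k ℕ.≤ m ℕ.+ ℕ-Sum.sum v
      sum≤ {zero}  k v k≤ = ℕ.z≤n
      sum≤ {suc m} k v k≤ = ℕ.≤-trans (ℕ.+-mono-≤ (k≤ zero) (sum≤ (k ∘ suc) (v ∘ suc) (k≤ ∘ suc)))
        (ℕ.≤-reflexive (≡.cong suc (swap (v zero) m _)))
        where
        swap : ∀ p q r → p ℕ.+ (q ℕ.+ r) ≡ q ℕ.+ (p ℕ.+ r)
        swap p q r = ≡.trans (≡.sym (ℕ.+-assoc p q r))
          (≡.trans (≡.cong (ℕ._+ r) (ℕ.+-comm p q)) (ℕ.+-assoc q p r))
      charged : ∀ i q → fromℕ (if q then e I i else 0) * β ≤ (if q then c i else 0#)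
      charged i true  = e≤c I i
      charged i false = ≤-reflexive (zeroˡ β)

    expectedCost-bound : ∀ T → ErrorAtMost 0# f (evaluate T) →
      expectedCost terminates ≤ β * fromℕ n + fromℕ N * offlineCost c T
    expectedCost-bound T exact = begin
      expectedCost terminates
        ≤⟨ 𝔼-mono (λ x → let I , consistent = result-invariant computation x ([]-consistent x) in
             totalInvestment-bound I x consistent (queried T x) (queried-certificate T T≡f x)) ⟩
      𝔼 (λ x → β * fromℕ n + fromℕ N * cost x)
        ≈⟨ 𝔼-+ (λ _ → β * fromℕ n) (λ x → fromℕ N * cost x) ⟩
      𝔼 {n} (λ _ → β * fromℕ n) + 𝔼 (λ x → fromℕ N * cost x)
        ≈⟨ +-cong (𝔼-const {n} _) (𝔼-*ˡ (fromℕ N) cost) ⟩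
      β * fromℕ n + fromℕ N * offlineCost c T ∎
      where
      open ≤-Reasoning
      cost : Input n → Carrier
      cost x = sum (λ i → if Vec.lookup (queried T x) i then c i else 0#)
      xor≡false⇒≡ : ∀ b b′ → b xor b′ ≡ false → b ≡ b′
      xor≡false⇒≡ true  true  _ = ≡.refl
      xor≡false⇒≡ false false _ = ≡.refl
      T≡f : ∀ x → evaluate T x ≡ f x
      T≡f x = xor≡false⇒≡ _ _ (mean≤0⇒false (λ y → evaluate T y xor f y) exact x)

    -- An infimum offers no optimal tree to compare with. Solving the bound for the offline cost
    -- instead makes (E - B) / N a lower bound for all zero-error trees, hence at most `opt`.
    opt-bound : ∀ {opt} → IsOpt₀ f c opt →
                expectedCost terminates ≤ β * fromℕ n + fromℕ N * opt
    opt-bound {opt} (_ , greatest) = begin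
      E                                            ≈⟨ +-identityʳ E ⟨
      E + 0#                                       ≈⟨ +-congˡ (-‿inverseˡ B) ⟨
      E + (- B + B)                                ≈⟨ solve 3 (λ p q r → p :+ (q :+ r) := r :+ (p :+ q)) refl E (- B) B ⟩
      B + (E + - B)                                ≈⟨ +-congˡ (*-inverse-cancelʳ′ 0<N _) ⟨
      B + (E + - B) * fromℕ N ⁻¹ * fromℕ N         ≤⟨ +-monoʳ-≤ B (*-monoˡ-≤ (proj₁ 0<N)
                                                        (greatest ((E + - B) * fromℕ N ⁻¹) lower)) ⟩
      B + opt * fromℕ N                            ≈⟨ +-congˡ (*-comm opt _) ⟩
      B + fromℕ N * opt                            ∎
      where
      open ≤-Reasoning
      E = expectedCost terminates
      B = β * fromℕ n
      0<N : 0# < fromℕ N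
      0<N = <-≤-trans (0<fromℕsuc 0) (fromℕ-mono (ℕ.*-mono-≤ (ℕ.s≤s (ℕ.z≤n {8})) 1≤l))
      lower : ∀ T → ErrorAtMost 0# f (evaluate T) → (E + - B) * fromℕ N ⁻¹ ≤ offlineCost c T
      lower T exact = *-cancelʳ-≤ 0<N (≤-respˡ-≈ (sym (*-inverse-cancelʳ′ 0<N _)) (begin
        E + - B                              ≤⟨ +-monoˡ-≤ (- B) (expectedCost-bound T exact) ⟩
        B + fromℕ N * offlineCost c T + - B  ≈⟨ solve 4 (λ b k o m → b :+ k :* o :+ m := (m :+ b) :+ o :* k) refl B (fromℕ N) _ (- B) ⟩
        (- B + B) + offlineCost c T * fromℕ N ≈⟨ trans (+-congʳ (-‿inverseˡ B)) (+-identityˡ _) ⟩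
        offlineCost c T * fromℕ N            ∎))

    -- Lets the factor N be replaced by a larger one in the product with `opt`.
    opt-nonNeg : ∀ {opt} → IsOpt₀ f c opt → 0# ≤ opt
    opt-nonNeg (_ , greatest) = greatest 0# (λ T _ →
      𝔼-nonNeg (λ x → sum-nonNeg (λ i → nonNeg i (Vec.lookup (queried T x) i))))
      where
      nonNeg : ∀ i q → 0# ≤ (if q then c i else 0#)
      nonNeg i true  = 0≤c i
      nonNeg i false = ≤-refl

-- Logarithms from their defining property.

module Logarithm {a ℓ₁ ℓ₂} (K : ArchimedeanOrderedField a ℓ₁ ℓ₂) where

  open PricedQueries K
  open OrderedField K

  -- The search descends from an exponent given by the Archimedean property and n < 2 ^ n; 1 < α
  -- stops it before it falls below exponent 0.
  ceiling-log₂ : ∀ α → fromℕ 1 < α →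
    ∃ λ k → α ≤ fromℕ (2 ℕ.^ suc k) × ¬ (α ≤ fromℕ (2 ℕ.^ k))
  ceiling-log₂ α 1<α = descend (proj₁ (archimedean α))
    (≤-trans (proj₂ (archimedean α)) (fromℕ-mono (ℕ.<⇒≤ (n<2^n (proj₁ (archimedean α))))))
    where
    descend : ∀ m → α ≤ fromℕ (2 ℕ.^ m) →
              ∃ λ k → α ≤ fromℕ (2 ℕ.^ suc k) × ¬ (α ≤ fromℕ (2 ℕ.^ k))
    descend zero    α≤1 = contradiction α≤1 (<⇒≱ 1<α)
    descend (suc m) α≤  with α ≤? fromℕ (2 ℕ.^ m)
    ... | yes α≤′ = descend m α≤′
    ... | no  α≰  = m , α≤ , α≰

  ^-mono-≤ : ∀ {x y} → 0# ≤ x → x ≤ y → ∀ m → x ^ m ≤ y ^ m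
  ^-mono-≤ 0≤x x≤y zero    = ≤-refl
  ^-mono-≤ 0≤x x≤y (suc m) = ≤-trans (*-monoˡ-≤ (^-nonNeg m) x≤y)
    (*-monoʳ-≤ (≤-trans 0≤x x≤y) (^-mono-≤ 0≤x x≤y m))
    where
    ^-nonNeg : ∀ m → 0# ≤ _ ^ m
    ^-nonNeg zero    = 0≤1
    ^-nonNeg (suc m) = *-nonNeg 0≤x (^-nonNeg m)

  -- If L < 1 then q L + 1 ≤ q for some q, contradicting 2 ^ q < 2 α ^ q.
  log₂≥1 : ∀ {α L} → 2# ≤ α → IsLog₂ α L → 1# ≤ L
  log₂≥1 {α} {L} 2≤α isLog with 1# ≤? L
  ... | yes 1≤L = 1≤L
  ... | no  1≰L = contradiction (Equivalence.to (isLog q q 1) qL+1≤q) (<⇒≱ (begin-strict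
    2# ^ q                 <⟨ ≤-<-trans (≤-reflexive (sym (*-identityʳ _))) 2^q*1<2^q*2 ⟩
    2# ^ q * (2# ^ 1)      ≤⟨ *-monoˡ-≤ (proj₁ (^-pos 0<2 1)) (^-mono-≤ (proj₁ 0<2) 2≤α q) ⟩
    α ^ q * 2# ^ 1         ∎))
    where
    open ≤-Reasoning
    δ = 1# + - L
    L+δ≈1 : L + δ ≈ 1#
    L+δ≈1 = trans (solve 3 (λ l o m → l :+ (o :+ m) := o :+ (m :+ l)) refl L 1# (- L))
      (trans (+-congˡ (-‿inverseˡ L)) (+-identityʳ 1#))
    0<δ : 0# < δ
    0<δ = ≰⇒> λ δ≤0 → 1≰L (begin
      1#       ≈⟨ L+δ≈1 ⟨
      L + δ    ≤⟨ +-monoʳ-≤ L δ≤0 ⟩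
      L + 0#   ≈⟨ +-identityʳ L ⟩
      L        ∎)
    q : ℕ
    q = proj₁ (archimedean (δ ⁻¹))
    1≤qδ : 1# ≤ fromℕ q * δ
    1≤qδ = ≤-respˡ-≈ (trans (*-comm _ δ) (*-inverseʳ (>⇒≉0 0<δ)))
      (*-monoˡ-≤ (proj₁ 0<δ) (proj₂ (archimedean (δ ⁻¹))))
    qL+1≤q : fromℕ q * L + fromℕ 1 ≤ fromℕ q
    qL+1≤q = begin
      fromℕ q * L + fromℕ 1       ≈⟨ +-congˡ (+-identityʳ 1#) ⟩
      fromℕ q * L + 1#            ≤⟨ +-monoʳ-≤ _ 1≤qδ ⟩
      fromℕ q * L + fromℕ q * δ   ≈⟨ distribˡ (fromℕ q) L δ ⟨
      fromℕ q * (L + δ)           ≈⟨ trans (*-congˡ L+δ≈1) (*-identityʳ _) ⟩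
      fromℕ q                     ∎
    1<2 : 1# < 2#
    1<2 = ≰⇒> λ 2≤1 → contradiction
      (fromℕ-cancel-≤ {2} {1} (≤-respʳ-≈ (sym (+-identityʳ 1#)) 2≤1)) λ { (ℕ.s≤s ()) }
    2^q*1<2^q*2 : 2# ^ q * 1# < 2# ^ q * 2# ^ 1
    2^q*1<2^q*2 = begin-strict
      2# ^ q * 1#       ≈⟨ *-comm _ 1# ⟩
      1# * 2# ^ q       <⟨ *-monoˡ-< (^-pos 0<2 q) 1<2 ⟩
      2# * 2# ^ q       ≈⟨ *-comm 2# _ ⟩
      2# ^ q * 2#       ≈⟨ *-congˡ (*-identityʳ 2#) ⟨
      2# ^ q * 2# ^ 1   ∎

  -- The instance p = k, q = 1, r = 0 of `IsLog₂`: from L ≤ k it would follow that α ≤ 2 ^ k.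
  below-log₂ : ∀ {α L} k → IsLog₂ α L → ¬ (α ≤ fromℕ (2 ℕ.^ k)) → fromℕ k ≤ L
  below-log₂ {α} {L} k isLog α≰2^k = proj₁ (≰⇒> λ L≤k → α≰2^k
    (≤-respˡ-≈ (trans (*-identityʳ (α * 1#)) (*-identityʳ α)) (≤-respʳ-≈ (sym (fromℕ-^ 2 k))
      (Equivalence.to (isLog k 1 0) (≤-respˡ-≈ (sym 1L+0≈L) L≤k)))))
    where
    1L+0≈L : fromℕ 1 * L + 0# ≈ L
    1L+0≈L = trans (+-identityʳ _) (trans (*-congʳ (+-identityʳ 1#)) (*-identityˡ L))

mainTheorem6 : ∀ {a ℓ₁ ℓ₂} →
    Σ ℕ λ C →
    (K : ArchimedeanOrderedField a ℓ₁ ℓ₂) →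
    let open PricedQueries K in
    ∀ n (f : BooleanFunction n) → Symmetric f →
    (c : Vector Carrier n) → (∀ i → 0# ≤ c i) →
    ∀ ε → 0# < ε → ε ≤ ½ →
    ∀ β → 0# < β →
    let open Online {n} β in
    (pick : TieBreaking f ε) →
    ∀ opt → IsOpt₀ f c opt →
    ∀ L → IsLog₂ (ε ⁻¹) L →
    Σ (Terminates (warmupIPRR f ε pick) c) λ t →
    ErrorAtMost ε f (outputs t) ×
    (expectedCost t ≤ β * fromℕ n + opt * (fromℕ C * L))
-- 18 = 9 · 2: the 9 comes from the tail bound, the 2 from rounding the logarithm up to an integer.
mainTheorem6 {a} {ℓ₁} {ℓ₂} = 18 , proof
  where
  proof : (K : ArchimedeanOrderedField a ℓ₁ ℓ₂) → _
  proof K n f f-sym c 0≤c ε 0<ε ε≤½ β 0<β pick opt isOpt L isLog =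
    terminates , outputs-error , ≤-trans (opt-bound isOpt) (+-monoʳ-≤ _ N*opt≤)
    where
    open PricedQueries K
    open OrderedField K
    open Logarithm K
    open ≤-Reasoning
    2≤ε⁻¹ : 2# ≤ ε ⁻¹
    2≤ε⁻¹ = *-cancelʳ-≤ 0<ε (begin
      2# * ε       ≤⟨ *-monoʳ-≤ (proj₁ 0<2) ε≤½ ⟩
      2# * ½       ≈⟨ *-inverseʳ (>⇒≉0 0<2) ⟩
      1#           ≈⟨ trans (*-comm _ ε) (*-inverseʳ (>⇒≉0 0<ε)) ⟨
      ε ⁻¹ * ε     ∎)
    1<ε⁻¹ : fromℕ 1 < ε ⁻¹
    1<ε⁻¹ = <-≤-trans (≰⇒> λ 2≤1 → contradiction (fromℕ-cancel-≤ {2} {1} 2≤1) λ { (ℕ.s≤s ()) }) 2≤ε⁻¹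
    k : ℕ
    k = proj₁ (ceiling-log₂ (ε ⁻¹) 1<ε⁻¹)
    1≤2^lε : 1# ≤ fromℕ (2 ℕ.^ suc k) * ε
    1≤2^lε = ≤-respˡ-≈ (trans (*-comm _ ε) (*-inverseʳ (>⇒≉0 0<ε)))
      (*-monoˡ-≤ (proj₁ 0<ε) (proj₁ (proj₂ (ceiling-log₂ (ε ⁻¹) 1<ε⁻¹))))
    open OnlineAnalysis K
    open WarmupIPRR f f-sym c 0≤c ε β 0<ε 0<β pick (suc k) (ℕ.s≤s ℕ.z≤n) 1≤2^lε
    -- Rounding up adds at most 1, and 1 ≤ L because ε ≤ ½.
    l≤2L : fromℕ (suc k) ≤ fromℕ 2 * L
    l≤2L = begin
      1# + fromℕ k   ≤⟨ +-mono-≤ (log₂≥1 2≤ε⁻¹ isLog)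
                          (below-log₂ k isLog (proj₂ (proj₂ (ceiling-log₂ (ε ⁻¹) 1<ε⁻¹)))) ⟩
      L + L          ≈⟨ solve 1 (λ x → x :+ x := (con 1 :+ (con 1 :+ con 0)) :* x) refl L ⟩
      fromℕ 2 * L    ∎
    N*opt≤ : fromℕ N * opt ≤ opt * (fromℕ 18 * L)
    N*opt≤ = begin
      fromℕ N * opt                       ≈⟨ *-comm _ opt ⟩
      opt * fromℕ (9 ℕ.* suc k)           ≈⟨ *-congˡ (fromℕ-* 9 (suc k)) ⟩
      opt * (fromℕ 9 * fromℕ (suc k))     ≤⟨ *-monoʳ-≤ (opt-nonNeg isOpt) (*-monoʳ-≤ (fromℕ-nonNeg 9) l≤2L) ⟩
      opt * (fromℕ 9 * (fromℕ 2 * L))     ≈⟨ *-congˡ (trans (sym (*-assoc _ _ L)) (*-congʳ (sym (fromℕ-* 9 2)))) ⟩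
      opt * (fromℕ 18 * L)                ∎
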